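{- The statistics constants satisfy $\lambda(3,2)=8/9$, $\lambda(4,2)=264/343$ and $\lambda(4,4)=26/27$.
   Context: A $d$-subcube of $\{0,1\}^n$ is a set $C\subseteq\{0,1\}^n$ obtained by fixing $n-d$ coordinates and letting the remaining $d$ coordinates vary arbitrarily (so $|C|=2^d$); there are $\binom nd 2^{n-d}$ of them. For integers $0\le s\le 2^d$, $n\ge d$ and $S\subseteq\{0,1\}^n$, let $\Lambda(S,d,s)$ be the number of $d$-subcubes $C$ with $|S\cap C|=s$, let $\Lambda(n,d,s)=\max\{\Lambda(S,d,s):S\subseteq\{0,1\}^n\}$, and let the statistics constant be $\lambda(d,s)=\lim_{n\to\infty}\Lambda(n,d,s)/\big(\binom nd 2^{n-d}\big)$ (the limit exists since the ratio is non-increasing in $n$). -}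

module Defs where

open import Data.Bool using (Bool; true; false; if_then_else_; _∧_)
open import Data.Maybe using (Maybe; just; nothing)
open import Data.Nat using (ℕ; zero; suc; _+_; _*_; _∸_; _^_; _≤_; _⊔_; _≡ᵇ_)
open import Data.Nat.Combinatorics using (_C_)
open import Data.List using (List; []; _∷_; map; concatMap; filter; length; foldr)
open import Data.Vec using (Vec; []; _∷_)
open import Data.Integer using (+_)
open import Data.Rational using (ℚ; 0ℚ; _/_; _-_; ∣_∣; _<_)
open import Data.Product using (∃)
open import Relation.Nullary.Decidable using (does)
open import Relation.Binary.PropositionalEquality using (_≡_)
open import Data.Bool.Properties using () renaming (_≟_ to _≟B_)

allVecs : (n : ℕ) → List (Vec Bool n)
allVecs zero = [] ∷ []
allVecs (suc n) = concatMap (λ b → map (b ∷_) (allVecs n)) (false ∷ true ∷ [])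

-- A subcube of {0,1}^n: nothing = free coordinate, just b = coordinate fixed to b.
Cube : ℕ → Set
Cube n = Vec (Maybe Bool) n

allCubes : (n : ℕ) → List (Cube n)
allCubes zero = [] ∷ []
allCubes (suc n) =
  concatMap (λ m → map (m ∷_) (allCubes n)) (nothing ∷ just false ∷ just true ∷ [])

dim : ∀ {n} → Cube n → ℕ
dim [] = 0
dim (nothing ∷ c) = suc (dim c)
dim (just _ ∷ c) = dim c

inCube : ∀ {n} → Vec Bool n → Cube n → Bool
inCube [] [] = true
inCube (x ∷ xs) (nothing ∷ c) = inCube xs c
inCube (x ∷ xs) (just b ∷ c) = does (x ≟B b) ∧ inCube xs c

Subset : ℕ → Set
Subset n = Vec Bool n → Bool

-- An enumeration of all subsets of {0,1}^n (every function Vec Bool n → Bool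
-- agrees pointwise with some element of this list).
allSubsets : (n : ℕ) → List (Subset n)
allSubsets zero = (λ _ → false) ∷ (λ _ → true) ∷ []
allSubsets (suc n) =
  concatMap (λ S₀ → map (λ S₁ → combine S₀ S₁) (allSubsets n)) (allSubsets n)
  where
  combine : Subset n → Subset n → Subset (suc n)
  combine S₀ S₁ (false ∷ x) = S₀ x
  combine S₀ S₁ (true ∷ x) = S₁ x

interSize : ∀ {n} → Subset n → Cube n → ℕ
interSize {n} S C = length (filter (λ x → (S x ∧ inCube x C) ≟B true) (allVecs n))

ΛS : ∀ {n} → Subset n → ℕ → ℕ → ℕ
ΛS {n} S d s =
  length (filter (λ C → ((dim C ≡ᵇ d) ∧ (interSize S C ≡ᵇ s)) ≟B true) (allCubes n))

Λ : ℕ → ℕ → ℕ → ℕ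
Λ n d s = foldr _⊔_ 0 (map (λ S → ΛS S d s) (allSubsets n))

numCubes : ℕ → ℕ → ℕ
numCubes n d = (n C d) * 2 ^ (n ∸ d)

-- a / b as a rational (b = 0 only happens for n < d, irrelevant for the limit)
frac : ℕ → ℕ → ℚ
frac a zero = 0ℚ
frac a (suc b) = (+ a) / suc b

ratio : ℕ → ℕ → ℕ → ℚ
ratio n d s = frac (Λ n d s) (numCubes n d)

ConvergesTo : (ℕ → ℚ) → ℚ → Set
ConvergesTo f r = ∀ (ε : ℚ) → 0ℚ < ε → ∃ λ N → ∀ n → N ≤ n → ∣ f n - r ∣ < ε

StatConstIs : ℕ → ℕ → ℚ → Set
StatConstIs d s r = ConvergesTo (λ n → ratio n d s) r

{-# OPTIONS --safe #-}

-- Upper bounds: sum functions of the labelling ε ↦ S(x ⊕ ε₁e_{i₁} ⊕ … ⊕ ε_de_{i_d}) over all base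
-- points x and all direction tuples, repetitions included.  For a fixed face F spanned by the first
-- d − 2 directions, ∑_j ∑_l w(F, F ⊕ e_j) w(F, F ⊕ e_l) is the square of ∑_j w(F, F ⊕ e_j), so it is
-- nonnegative with no error term.  A suitable positive combination of such squares, summed over the
-- (d − 2)-faces of the d-cube, is at most K (num − den [ |S ∩ C| = s ]) for each of the 2^(2^d)
-- labellings of C, whence the density of cubes with |S ∩ C| = s is at most num / den up to the
-- proportion O(1/n) of degenerate tuples.  The weights were found by semidefinite programming.
--
-- Lower bounds: give each coordinate i a nonzero colour cᵢ ∈ F₂^k and let S = {x : ∑ xᵢcᵢ = 0}.  A
-- d-subcube whose free coordinates have spanning colours meets S in 2^(d−k) points.  Averaging over
-- all colourings gives, for every n, the proportion of spanning d-tuples of nonzero vectors: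
-- 24/27, 1848/2401 and 78/81.

module Submission where

open import Defs
open import Data.Bool using (Bool; true; false; not; _∧_; _xor_; if_then_else_)
open import Data.Bool.Properties using (not-involutive; xor-assoc; xor-comm; T-≡) renaming (_≟_ to _≟B_)
open import Data.Fin using (Fin; zero; suc)
open import Data.List using (List; []; _∷_; _++_; map; filter; length; foldr)
import Data.List as List
open import Data.List.Membership.Propositional using (_∈_)
open import Data.List.Membership.Propositional.Properties using (∈-concatMap⁺; ∈-map⁺)
open import Data.List.Properties using (filter-++; length-++)
open import Data.List.Relation.Unary.Any using (here; there)
import Data.List.Relation.Unary.Any as Any
open import Data.Maybe using (just; nothing)
open import Data.Nat hiding (_/_)
import Data.Nat.Combinatorics as Comb
open import Data.Nat.Coprimality using (Coprime)
open import Data.Nat.Properties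
open import Data.Nat.Tactic.RingSolver using (solve-∀)
open import Data.Product using (_×_; _,_; ∃; proj₁; proj₂; swap; uncurry)
open import Data.Vec using (Vec; []; _∷_; replicate; updateAt; zipWith)
open import Data.Vec.Properties using (updateAt-updateAt-local; updateAt-id)
open import Function using (_∘_; it)
open import Function.Bundles using (Equivalence)
open import Relation.Binary.PropositionalEquality
open import Relation.Nullary using (contradiction; yes; no)
open import Relation.Nullary.Decidable using (toWitness)
open import Algebra.Properties.CommutativeMonoid.Sum +-0-commutativeMonoid using (sum; ∑-distrib-+; ∑-comm; sum-cong-≗)
open import Algebra.Properties.CommutativeSemigroup +-commutativeSemigroup using () renaming (interchange to +-interchange)

-- Sums over vertices and coordinate flips.

Vertex : ℕ → Set
Vertex = Vec Bool

𝟙 : Bool → ℕ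
𝟙 b = if b then 1 else 0

flip : ∀ {n} → Fin n → Vertex n → Vertex n
flip i x = updateAt x i not

flip-involutive : ∀ {n} (i : Fin n) x → flip i (flip i x) ≡ x
flip-involutive i x =
  trans (updateAt-updateAt-local i x (not-involutive _)) (updateAt-id i x)

flip-comm : ∀ {n} (i j : Fin n) x → flip i (flip j x) ≡ flip j (flip i x)
flip-comm zero zero (a ∷ x) = refl
flip-comm zero (suc j) (a ∷ x) = refl
flip-comm (suc i) zero (a ∷ x) = refl
flip-comm (suc i) (suc j) (a ∷ x) = cong (a ∷_) (flip-comm i j x)

sum-mono : ∀ {n} {f g : Fin n → ℕ} → (∀ i → f i ≤ g i) → sum f ≤ sum g
sum-mono {zero} f≤g = z≤n
sum-mono {suc n} f≤g = +-mono-≤ (f≤g zero) (sum-mono (f≤g ∘ suc))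

sum-const : ∀ n c → sum {n} (λ _ → c) ≡ n * c
sum-const zero c = refl
sum-const (suc n) c = cong (c +_) (sum-const n c)

sum-distribˡ : ∀ {n} c (f : Fin n → ℕ) → sum (λ i → c * f i) ≡ c * sum f
sum-distribˡ {zero} c f = sym (*-zeroʳ c)
sum-distribˡ {suc n} c f =
  trans (cong (c * f zero +_) (sum-distribˡ c (f ∘ suc))) (sym (*-distribˡ-+ c (f zero) _))

sumV : ∀ {n} → (Vertex n → ℕ) → ℕ
sumV {zero} f = f []
sumV {suc n} f = sumV (λ x → f (false ∷ x)) + sumV (λ x → f (true ∷ x))

sumV-cong : ∀ {n} {f g : Vertex n → ℕ} → f ≗ g → sumV f ≡ sumV g
sumV-cong {zero} f≗g = f≗g []
sumV-cong {suc n} f≗g =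
  cong₂ _+_ (sumV-cong (f≗g ∘ (false ∷_))) (sumV-cong (f≗g ∘ (true ∷_)))

sumV-mono : ∀ {n} {f g : Vertex n → ℕ} → (∀ x → f x ≤ g x) → sumV f ≤ sumV g
sumV-mono {zero} f≤g = f≤g []
sumV-mono {suc n} f≤g =
  +-mono-≤ (sumV-mono (f≤g ∘ (false ∷_))) (sumV-mono (f≤g ∘ (true ∷_)))

sumV-+ : ∀ {n} (f g : Vertex n → ℕ) → sumV (λ x → f x + g x) ≡ sumV f + sumV g
sumV-+ {zero} f g = refl
sumV-+ {suc n} f g = trans
  (cong₂ _+_ (sumV-+ (f ∘ (false ∷_)) (g ∘ (false ∷_))) (sumV-+ (f ∘ (true ∷_)) (g ∘ (true ∷_))))
  (+-interchange (sumV (f ∘ (false ∷_))) _ _ _)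

sumV-const : ∀ n c → sumV {n} (λ _ → c) ≡ 2 ^ n * c
sumV-const zero c = sym (*-identityˡ c)
sumV-const (suc n) c = begin
  sumV {n} (λ _ → c) + sumV {n} (λ _ → c) ≡⟨ cong₂ _+_ (sumV-const n c) (sumV-const n c) ⟩
  2 ^ n * c + 2 ^ n * c                   ≡⟨ *-distribʳ-+ c (2 ^ n) (2 ^ n) ⟨
  (2 ^ n + 2 ^ n) * c                     ≡⟨ cong (λ m → (2 ^ n + m) * c) (+-identityʳ (2 ^ n)) ⟨
  2 ^ suc n * c ∎
  where open ≡-Reasoning

sumV-*0 : ∀ {n} (f : Vertex n → ℕ) → sumV (λ x → f x * 0) ≡ 0
sumV-*0 {n} f = trans (sumV-cong (*-zeroʳ ∘ f)) (trans (sumV-const n 0) (*-zeroʳ (2 ^ n)))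

sumV-flip : ∀ {n} (i : Fin n) (f : Vertex n → ℕ) → sumV (f ∘ flip i) ≡ sumV f
sumV-flip zero f = +-comm (sumV (f ∘ (true ∷_))) _
sumV-flip (suc i) f =
  cong₂ _+_ (sumV-flip i (f ∘ (false ∷_))) (sumV-flip i (f ∘ (true ∷_)))

sumV-∑-comm : ∀ {n m} (f : Vertex n → Fin m → ℕ) →
              sum (λ i → sumV (λ x → f x i)) ≡ sumV (λ x → sum (f x))
sumV-∑-comm {zero} f = refl
sumV-∑-comm {suc n} f = trans
  (∑-distrib-+ (λ i → sumV (λ x → f (false ∷ x) i)) (λ i → sumV (λ x → f (true ∷ x) i)))
  (cong₂ _+_ (sumV-∑-comm (f ∘ (false ∷_))) (sumV-∑-comm (f ∘ (true ∷_))))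

-- Cube labellings and sums over direction tuples.

-- Pow d A is the type of A-labellings of the d-cube, the first direction being the innermost pairing.
Pow : ℕ → Set → Set
Pow zero A = A
Pow (suc d) A = Pow d (A × A)

pair : ∀ {A B : Set} → (A → B) → A × A → B × B
pair g (a , b) = g a , g b

mapPow : ∀ d {A B : Set} → (A → B) → Pow d A → Pow d B
mapPow zero g = g
mapPow (suc d) g = mapPow d (pair g)

D : ∀ {n} {A : Set} → Fin n → (Vertex n → A) → Vertex n → A × A
D i f x = f x , f (flip i x)

-- The sum of h over the labellings x ↦ f (x ⊕ ε₁e_{i₁} ⊕ … ⊕ ε_de_{i_d}) for all base
-- points x and all direction tuples (i₁, …, i_d), repetitions included.
T : ∀ {n} d {A : Set} → (Pow d A → ℕ) → (Vertex n → A) → ℕ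
T zero h f = sumV (h ∘ f)
T (suc d) h f = sum λ i → T d h (D i f)

T-cong : ∀ {n} d {A : Set} (h : Pow d A → ℕ) {f g : Vertex n → A} → f ≗ g → T d h f ≡ T d h g
T-cong zero h f≗g = sumV-cong (cong h ∘ f≗g)
T-cong (suc d) h f≗g = sum-cong-≗ λ i → T-cong d h λ x → cong₂ _,_ (f≗g x) (f≗g (flip i x))

T-mono : ∀ {n} d {A : Set} {h k : Pow d A → ℕ} → (∀ φ → h φ ≤ k φ) → (f : Vertex n → A) →
         T d h f ≤ T d k f
T-mono zero h≤k f = sumV-mono (h≤k ∘ f)
T-mono (suc d) h≤k f = sum-mono λ i → T-mono d h≤k (D i f)

T-+ : ∀ {n} d {A : Set} (h k : Pow d A → ℕ) (f : Vertex n → A) →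
      T d (λ φ → h φ + k φ) f ≡ T d h f + T d k f
T-+ zero h k f = sumV-+ (h ∘ f) (k ∘ f)
T-+ (suc d) h k f =
  trans (sum-cong-≗ λ i → T-+ d h k (D i f)) (∑-distrib-+ (λ i → T d h (D i f)) _)

T-const : ∀ {n} d {A : Set} c (f : Vertex n → A) → T d (λ _ → c) f ≡ n ^ d * (2 ^ n * c)
T-const {n} zero c f = trans (sumV-const n c) (sym (*-identityˡ _))
T-const {n} (suc d) c f = begin
  sum (λ i → T d (λ _ → c) (D i f))       ≡⟨ sum-cong-≗ (λ i → T-const d c (D i f)) ⟩
  sum {n} (λ _ → n ^ d * (2 ^ n * c))     ≡⟨ sum-const n _ ⟩
  n * (n ^ d * (2 ^ n * c))               ≡⟨ *-assoc n (n ^ d) _ ⟨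
  n ^ suc d * (2 ^ n * c) ∎
  where open ≡-Reasoning

T-*ˡ : ∀ {n} d {A : Set} c (h : Pow d A → ℕ) (f : Vertex n → A) →
       T d (λ φ → c * h φ) f ≡ c * T d h f
T-*ˡ {n} d zero h f =
  trans (T-const d 0 f) (trans (cong (n ^ d *_) (*-zeroʳ (2 ^ n))) (*-zeroʳ (n ^ d)))
T-*ˡ d (suc c) h f = trans (T-+ d h (λ φ → c * h φ) f) (cong (T d h f +_) (T-*ˡ d c h f))

T-map : ∀ {n} d {A B : Set} (g : A → B) (h : Pow d B → ℕ) (f : Vertex n → A) →
        T d (h ∘ mapPow d g) f ≡ T d h (g ∘ f)
T-map zero g h f = refl
T-map (suc d) g h f = sum-cong-≗ λ i → T-map d (pair g) h (D i f)

-- Flips commute, so translating `f` only translates the base point of every cube, and `sumV-flip`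
-- absorbs that.
T-flip : ∀ {n} d {A : Set} (h : Pow d A → ℕ) (i : Fin n) (f : Vertex n → A) →
         T d h (f ∘ flip i) ≡ T d h f
T-flip zero h i f = sumV-flip i (h ∘ f)
T-flip (suc d) h i f = sum-cong-≗ λ j → trans
  (T-cong d h λ x → cong (λ y → f (flip i x) , f y) (flip-comm i j x))
  (T-flip d h i (D j f))

-- Symmetries of the cube of directions.

record Symmetry (d : ℕ) {A : Set} (γ : Pow d A → Pow d A) : Set where
  field invariant : ∀ {n} h (f : Vertex n → A) → T d (h ∘ γ) f ≡ T d h f
open Symmetry

-- Moving the base point from `x` to `flip i x` exchanges the two ends of the first direction.
reflect-sym : ∀ d {A : Set} → Symmetry (suc d) {A} (mapPow d swap)
reflect-sym d .invariant h f = sum-cong-≗ λ i → begin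
  T d (h ∘ mapPow d swap) (D i f)  ≡⟨ T-map d swap h (D i f) ⟩
  T d h (swap ∘ D i f)             ≡⟨ T-cong d h (λ x → cong (λ y → f (flip i x) , f y) (flip-involutive i x)) ⟨
  T d h (D i f ∘ flip i)           ≡⟨ T-flip d h i (D i f) ⟩
  T d h (D i f) ∎
  where open ≡-Reasoning

transpose : ∀ {A : Set} → (A × A) × (A × A) → (A × A) × (A × A)
transpose ((a , b) , (c , d)) = (a , c) , (b , d)

-- Exchanging the first two directions renames the summation variables `i` and `j`.
transpose-sym : ∀ d {A : Set} → Symmetry (2 + d) {A} (mapPow d transpose)
transpose-sym d .invariant h f = begin
  sum (λ i → sum (λ j → T d (h ∘ mapPow d transpose) (D j (D i f))))
    ≡⟨ sum-cong-≗ (λ i → sum-cong-≗ λ j → T-map d transpose h (D j (D i f))) ⟩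
  sum (λ i → sum (λ j → T d h (transpose ∘ D j (D i f))))
    ≡⟨ sum-cong-≗ (λ i → sum-cong-≗ λ j → T-cong d h λ x →
         cong (λ y → (f x , f (flip j x)) , (f (flip i x) , f y)) (flip-comm i j x)) ⟩
  sum (λ i → sum (λ j → T d h (D i (D j f))))
    ≡⟨ ∑-comm (λ i j → T d h (D i (D j f))) ⟩
  sum (λ j → sum (λ i → T d h (D i (D j f)))) ∎
  where open ≡-Reasoning

-- The added direction is innermost, so `γ` now acts on the directions with indices raised by one.
lift-sym : ∀ d {A : Set} {γ : Pow d (A × A) → Pow d (A × A)} →
           Symmetry d {A × A} γ → Symmetry (suc d) {A} γ
lift-sym d s .invariant h f = sum-cong-≗ λ i → s .invariant h (D i f)

-- Counting subcubes

total : ∀ d → Pow d ℕ → ℕ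
total zero m = m
total (suc d) φ = total d (mapPow d (uncurry _+_) φ)

Add : ∀ {n} → Fin n → (Vertex n → ℕ) → Vertex n → ℕ
Add i f x = f x + f (flip i x)

sumC : ∀ {n} → (Cube n → ℕ) → ℕ
sumC {zero} h = h []
sumC {suc n} h =
  sumC (λ C → h (nothing ∷ C)) + (sumC (λ C → h (just false ∷ C)) + sumC (λ C → h (just true ∷ C)))

sumC-cong : ∀ {n} {f g : Cube n → ℕ} → f ≗ g → sumC f ≡ sumC g
sumC-cong {zero} f≗g = f≗g []
sumC-cong {suc n} f≗g = cong₂ _+_ (sumC-cong (f≗g ∘ (nothing ∷_)))
  (cong₂ _+_ (sumC-cong (f≗g ∘ (just false ∷_))) (sumC-cong (f≗g ∘ (just true ∷_))))

sumC-mono : ∀ {n} {f g : Cube n → ℕ} → (∀ C → f C ≤ g C) → sumC f ≤ sumC g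
sumC-mono {zero} f≤g = f≤g []
sumC-mono {suc n} f≤g = +-mono-≤ (sumC-mono (f≤g ∘ (nothing ∷_)))
  (+-mono-≤ (sumC-mono (f≤g ∘ (just false ∷_))) (sumC-mono (f≤g ∘ (just true ∷_))))

sumC-zero : ∀ n → sumC {n} (λ _ → 0) ≡ 0
sumC-zero zero = refl
sumC-zero (suc n) = cong₂ _+_ (sumC-zero n) (cong₂ _+_ (sumC-zero n) (sumC-zero n))

-- Contracting a free coordinate adds the two halves of `f`, which leads out of the indicator
-- functions; hence `f` takes values in `ℕ`.
cubeSum : ∀ {n} → (Vertex n → ℕ) → Cube n → ℕ
cubeSum f [] = f []
cubeSum f (nothing ∷ C) = cubeSum (λ x → f (false ∷ x) + f (true ∷ x)) C
cubeSum f (just b ∷ C) = cubeSum (λ x → f (b ∷ x)) C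

cubeSum-cong : ∀ {n} {f g : Vertex n → ℕ} → f ≗ g → ∀ C → cubeSum f C ≡ cubeSum g C
cubeSum-cong f≗g [] = f≗g []
cubeSum-cong f≗g (nothing ∷ C) =
  cubeSum-cong (λ x → cong₂ _+_ (f≗g (false ∷ x)) (f≗g (true ∷ x))) C
cubeSum-cong f≗g (just b ∷ C) = cubeSum-cong (λ x → f≗g (b ∷ x)) C

module _ (s : ℕ) where

  cubes : ∀ {n} → ℕ → (Vertex n → ℕ) → ℕ
  cubes d f = sumC λ C → 𝟙 ((dim C ≡ᵇ d) ∧ (cubeSum f C ≡ᵇ s))

  hits : ∀ {n} d → (Vertex n → ℕ) → ℕ
  hits d = T d (λ φ → 𝟙 (total d φ ≡ᵇ s))

  hits-suc : ∀ {n} d (f : Vertex n → ℕ) → hits (suc d) f ≡ sum (λ i → hits d (Add i f))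
  hits-suc d f = sum-cong-≗ λ i → T-map d (uncurry _+_) (λ φ → 𝟙 (total d φ ≡ᵇ s)) (D i f)

  hits-cong : ∀ {n} d {f g : Vertex n → ℕ} → f ≗ g → hits d f ≡ hits d g
  hits-cong d = T-cong d _

  hits-suc₂ : ∀ {n} d (f g : Vertex n → ℕ) →
    hits (suc d) f + hits (suc d) g ≡ sum (λ i → hits d (Add i f) + hits d (Add i g))
  hits-suc₂ d f g = trans (cong₂ _+_ (hits-suc d f) (hits-suc d g))
    (sym (∑-distrib-+ (λ i → hits d (Add i f)) (λ i → hits d (Add i g))))

  -- Tuples that avoid the new direction stay within one half of the cube; only these are kept.
  hits-halves : ∀ {n} d (f : Vertex (suc n) → ℕ) →
           hits d (f ∘ (false ∷_)) + hits d (f ∘ (true ∷_)) ≤ hits d f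
  hits-halves zero f = ≤-refl
  hits-halves (suc d) f = begin
    hits (suc d) (f ∘ (false ∷_)) + hits (suc d) (f ∘ (true ∷_))
      ≡⟨ hits-suc₂ d (f ∘ (false ∷_)) (f ∘ (true ∷_)) ⟩
    sum (λ i → hits d (Add i (f ∘ (false ∷_))) + hits d (Add i (f ∘ (true ∷_))))
      ≤⟨ sum-mono (λ i → hits-halves d (Add (suc i) f)) ⟩
    sum (λ i → hits d (Add (suc i) f))
      ≤⟨ m≤n+m _ (hits d (Add zero f)) ⟩
    hits d (Add zero f) + sum (λ i → hits d (Add (suc i) f))
      ≡⟨ hits-suc d f ⟨
    hits (suc d) f ∎
    where open ≤-Reasoning

  merge : ∀ {n} → (Vertex (suc n) → ℕ) → Vertex n → ℕ
  merge f x = f (false ∷ x) + f (true ∷ x)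

  -- Once the new direction has been used, both halves carry `merge f`, so each hit of `merge f`
  -- occurs for two base points. Further uses of the new direction are dropped.
  hits-Add-zero : ∀ {n} d (f : Vertex (suc n) → ℕ) → 2 * hits d (merge f) ≤ hits d (Add zero f)
  hits-Add-zero d f = begin
    2 * hits d (merge f)                          ≡⟨ cong (hits d (merge f) +_) (+-identityʳ _) ⟩
    hits d (merge f) + hits d (merge f)            ≡⟨ cong (hits d (merge f) +_) (hits-cong d λ x → +-comm (f (false ∷ x)) _) ⟩
    hits d (merge f) + hits d (Add zero f ∘ (true ∷_)) ≤⟨ hits-halves d (Add zero f) ⟩
    hits d (Add zero f) ∎
    where open ≤-Reasoning

  -- The two summands count the tuples avoiding the new direction and those using it exactly once.
  hits-step : ∀ {n} d (f : Vertex (suc n) → ℕ) →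
    (hits (suc d) (f ∘ (false ∷_)) + hits (suc d) (f ∘ (true ∷_))) + suc d * (2 * hits d (merge f))
      ≤ hits (suc d) f
  -- The first direction is an old one here, so the new one can occupy any of the `d` other
  -- positions. The induction is joint with `hits-step`, which adds the case where the new direction
  -- comes first.
  hits-Add-suc : ∀ {n} d (f : Vertex (suc n) → ℕ) →
    (hits (suc d) (f ∘ (false ∷_)) + hits (suc d) (f ∘ (true ∷_))) + d * (2 * hits d (merge f))
      ≤ sum (λ i → hits d (Add (suc i) f))

  hits-step d f = begin
    (hits (suc d) (f ∘ (false ∷_)) + hits (suc d) (f ∘ (true ∷_))) + (h + d * h)
      ≡⟨ +-assoc a h (d * h) ⟨
    a + h + d * h            ≡⟨ cong (_+ d * h) (+-comm a h) ⟩
    h + a + d * h            ≡⟨ +-assoc h a (d * h) ⟩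
    h + (a + d * h)          ≤⟨ +-mono-≤ (hits-Add-zero d f) (hits-Add-suc d f) ⟩
    hits d (Add zero f) + sum (λ i → hits d (Add (suc i) f)) ≡⟨ hits-suc d f ⟨
    hits (suc d) f ∎
    where
    open ≤-Reasoning
    a h : ℕ
    a = hits (suc d) (f ∘ (false ∷_)) + hits (suc d) (f ∘ (true ∷_))
    h = 2 * hits d (merge f)

  hits-Add-suc zero f = begin
    hits 1 (f ∘ (false ∷_)) + hits 1 (f ∘ (true ∷_)) + 0 ≡⟨ +-identityʳ _ ⟩
    hits 1 (f ∘ (false ∷_)) + hits 1 (f ∘ (true ∷_))
      ≡⟨ hits-suc₂ 0 (f ∘ (false ∷_)) (f ∘ (true ∷_)) ⟩
    sum (λ i → hits 0 (Add (suc i) f)) ∎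
    where open ≤-Reasoning
  hits-Add-suc (suc d) f = begin
    hits (2 + d) f₀ + hits (2 + d) f₁ + suc d * (2 * hits (suc d) (merge f))
      ≡⟨ cong₂ _+_ (hits-suc₂ (suc d) f₀ f₁) inner ⟩
    sum (λ i → hits (suc d) (Add i f₀) + hits (suc d) (Add i f₁)) + sum extra
      ≡⟨ ∑-distrib-+ (λ i → hits (suc d) (Add i f₀) + hits (suc d) (Add i f₁)) extra ⟨
    sum (λ i → hits (suc d) (Add i f₀) + hits (suc d) (Add i f₁) + extra i)
      ≤⟨ sum-mono (λ i → hits-step d (Add (suc i) f)) ⟩
    sum (λ i → hits (suc d) (Add (suc i) f)) ∎
    where
    open ≤-Reasoning
    f₀ = f ∘ (false ∷_)
    f₁ = f ∘ (true ∷_)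
    extra : Fin _ → ℕ
    extra i = suc d * (2 * hits d (merge (Add (suc i) f)))
    inner : suc d * (2 * hits (suc d) (merge f)) ≡ sum extra
    inner = begin-equality
      suc d * (2 * hits (suc d) (merge f))
        ≡⟨ cong (λ m → suc d * (2 * m)) (hits-suc d (merge f)) ⟩
      suc d * (2 * sum (λ i → hits d (Add i (merge f))))
        ≡⟨ cong (λ m → suc d * (2 * m)) (sum-cong-≗ λ i →
             hits-cong d λ x → +-interchange (f₀ x) (f₁ x) (f₀ (flip i x)) (f₁ (flip i x))) ⟩
      suc d * (2 * sum (λ i → hits d (merge (Add (suc i) f))))
        ≡⟨ cong (suc d *_) (sum-distribˡ 2 (λ i → hits d (merge (Add (suc i) f)))) ⟨
      suc d * sum (λ i → 2 * hits d (merge (Add (suc i) f)))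
        ≡⟨ sum-distribˡ (suc d) (λ i → 2 * hits d (merge (Add (suc i) f))) ⟨
      sum extra ∎

  -- A `d`-subcube arises from `d !` orders of its free directions and `2 ^ d` base points. Tuples
  -- with a repeated direction may be hits as well, hence only an inequality.
  cubes≤hits : ∀ n d (f : Vertex n → ℕ) → d ! * 2 ^ d * cubes d f ≤ hits d f
  cubes≤hits zero zero f = ≤-reflexive (*-identityˡ _)
  cubes≤hits zero (suc d) f = ≤-trans (≤-reflexive (*-zeroʳ (suc d ! * 2 ^ suc d))) z≤n
  cubes≤hits (suc n) zero f = begin
    1 * cubes zero f                         ≡⟨ *-identityˡ _ ⟩
    sumC {n} (λ _ → 0) + (cubes zero f₀ + cubes zero f₁) 
      ≡⟨ cong (_+ (cubes zero f₀ + cubes zero f₁)) (sumC-zero n) ⟩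
    cubes zero f₀ + cubes zero f₁            ≡⟨ cong₂ _+_ (*-identityˡ (cubes zero f₀)) (*-identityˡ (cubes zero f₁)) ⟨
    1 * cubes zero f₀ + 1 * cubes zero f₁    ≤⟨ +-mono-≤ (cubes≤hits n zero f₀) (cubes≤hits n zero f₁) ⟩
    hits zero f ∎
    where
    open ≤-Reasoning
    f₀ = f ∘ (false ∷_)
    f₁ = f ∘ (true ∷_)
  cubes≤hits (suc n) (suc d) f = begin
    k' * (cubes d (merge f) + (cubes (suc d) f₀ + cubes (suc d) f₁))
      ≡⟨ *-distribˡ-+ k' (cubes d (merge f)) _ ⟩
    k' * cubes d (merge f) + k' * (cubes (suc d) f₀ + cubes (suc d) f₁)
      ≡⟨ cong₂ _+_ arith (*-distribˡ-+ k' (cubes (suc d) f₀) _) ⟩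
    suc d * (2 * (k * cubes d (merge f))) + (k' * cubes (suc d) f₀ + k' * cubes (suc d) f₁)
      ≤⟨ +-mono-≤ (*-monoʳ-≤ (suc d) (*-monoʳ-≤ 2 (cubes≤hits n d (merge f))))
           (+-mono-≤ (cubes≤hits n (suc d) f₀) (cubes≤hits n (suc d) f₁)) ⟩
    suc d * (2 * hits d (merge f)) + (hits (suc d) f₀ + hits (suc d) f₁)
      ≡⟨ +-comm (suc d * (2 * hits d (merge f))) _ ⟩
    hits (suc d) f₀ + hits (suc d) f₁ + suc d * (2 * hits d (merge f))
      ≤⟨ hits-step d f ⟩
    hits (suc d) f ∎
    where
    open ≤-Reasoning
    f₀ = f ∘ (false ∷_)
    f₁ = f ∘ (true ∷_)
    k k' : ℕ
    k = d ! * 2 ^ d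
    k' = suc d ! * 2 ^ suc d
    arith : k' * cubes d (merge f) ≡ suc d * (2 * (k * cubes d (merge f)))
    arith = ar (suc d) (d !) (2 ^ d) (cubes d (merge f))
      where
      ar : ∀ a b c e → (a * b) * (2 * c) * e ≡ a * (2 * ((b * c) * e))
      ar = solve-∀

-- Counts over lists as sums.

count-map : ∀ {A B : Set} (p : B → Bool) (g : A → B) xs →
  length (filter (λ y → p y ≟B true) (map g xs)) ≡ length (filter (λ x → p (g x) ≟B true) xs)
count-map p g [] = refl
count-map p g (x ∷ xs) with p (g x)
... | true = cong suc (count-map p g xs)
... | false = count-map p g xs

count-++ : ∀ {A : Set} (p : A → Bool) xs ys →
  length (filter (λ x → p x ≟B true) (xs ++ ys)) ≡
  length (filter (λ x → p x ≟B true) xs) + length (filter (λ x → p x ≟B true) ys)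
count-++ p xs ys =
  trans (cong length (filter-++ (λ x → p x ≟B true) xs ys)) (length-++ (filter (λ x → p x ≟B true) xs))

count-single : ∀ {A : Set} (p : A → Bool) x → length (filter (λ x → p x ≟B true) (x ∷ [])) ≡ 𝟙 (p x)
count-single p x with p x
... | true = refl
... | false = refl

count-allVecs : ∀ n (p : Vertex n → Bool) →
                length (filter (λ x → p x ≟B true) (allVecs n)) ≡ sumV (𝟙 ∘ p)
count-allVecs zero p = count-single p []
count-allVecs (suc n) p = trans (count-++ p (map (false ∷_) (allVecs n)) _)
  (cong₂ _+_ (half false) (trans (count-++ p (map (true ∷_) (allVecs n)) []) (trans (+-identityʳ _) (half true))))
  where
  half : ∀ b → length (filter (λ x → p x ≟B true) (map (b ∷_) (allVecs n))) ≡ sumV (𝟙 ∘ p ∘ (b ∷_))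
  half b = trans (count-map p (b ∷_) (allVecs n)) (count-allVecs n (p ∘ (b ∷_)))

count-allCubes : ∀ n (p : Cube n → Bool) →
                 length (filter (λ C → p C ≟B true) (allCubes n)) ≡ sumC (𝟙 ∘ p)
count-allCubes zero p = count-single p []
count-allCubes (suc n) p = trans (count-++ p (map (nothing ∷_) (allCubes n)) _)
  (cong₂ _+_ (part nothing) (trans (count-++ p (map (just false ∷_) (allCubes n)) _)
    (cong₂ _+_ (part (just false))
      (trans (count-++ p (map (just true ∷_) (allCubes n)) []) (trans (+-identityʳ _) (part (just true)))))))
  where
  part : ∀ m → length (filter (λ x → p x ≟B true) (map (m ∷_) (allCubes n))) ≡ sumC (𝟙 ∘ p ∘ (m ∷_))
  part m = trans (count-map p (m ∷_) (allCubes n)) (count-allCubes n (p ∘ (m ∷_)))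

sumV-inCube : ∀ {n} (f : Vertex n → ℕ) C → sumV (λ x → f x * 𝟙 (inCube x C)) ≡ cubeSum f C
sumV-inCube f [] = *-identityʳ _
sumV-inCube f (nothing ∷ C) = begin
  sumV (λ x → f (false ∷ x) * 𝟙 (inCube x C)) + sumV (λ x → f (true ∷ x) * 𝟙 (inCube x C))
    ≡⟨ sumV-+ (λ x → f (false ∷ x) * 𝟙 (inCube x C)) _ ⟨
  sumV (λ x → f (false ∷ x) * 𝟙 (inCube x C) + f (true ∷ x) * 𝟙 (inCube x C))
    ≡⟨ sumV-cong (λ x → *-distribʳ-+ (𝟙 (inCube x C)) (f (false ∷ x)) (f (true ∷ x))) ⟨
  sumV (λ x → (f (false ∷ x) + f (true ∷ x)) * 𝟙 (inCube x C))
    ≡⟨ sumV-inCube (λ x → f (false ∷ x) + f (true ∷ x)) C ⟩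
  cubeSum f (nothing ∷ C) ∎
  where open ≡-Reasoning
sumV-inCube f (just false ∷ C) = trans
  (cong₂ _+_ (sumV-inCube (f ∘ (false ∷_)) C) (sumV-*0 (f ∘ (true ∷_)))) (+-identityʳ _)
sumV-inCube f (just true ∷ C) =
  cong₂ _+_ (sumV-*0 (f ∘ (false ∷_))) (sumV-inCube (f ∘ (true ∷_)) C)

𝟙-∧ : ∀ a b → 𝟙 (a ∧ b) ≡ 𝟙 a * 𝟙 b
𝟙-∧ false b = refl
𝟙-∧ true b = sym (*-identityˡ _)

interSize≡cubeSum : ∀ {n} (S : Subset n) C → interSize S C ≡ cubeSum (𝟙 ∘ S) C
interSize≡cubeSum {n} S C = trans (count-allVecs n (λ x → S x ∧ inCube x C))
  (trans (sumV-cong λ x → 𝟙-∧ (S x) (inCube x C)) (sumV-inCube (𝟙 ∘ S) C))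

ΛS≡cubes : ∀ {n} (S : Subset n) d s → ΛS S d s ≡ cubes s d (𝟙 ∘ S)
ΛS≡cubes {n} S d s = trans
  (count-allCubes n λ C → (dim C ≡ᵇ d) ∧ (interSize S C ≡ᵇ s))
  (sumC-cong λ C → cong (λ m → 𝟙 ((dim C ≡ᵇ d) ∧ (m ≡ᵇ s))) (interSize≡cubeSum S C))

-- Lower bounds

-- A subset is a function, so it is found in the enumeration only up to pointwise equality;
-- `ΛS-cong` makes this sufficient.
allSubsets-complete : ∀ n (S : Subset n) → ∃ λ S′ → S′ ∈ allSubsets n × S ≗ S′
allSubsets-complete zero S with S [] in eq
... | false = _ , here refl , λ { [] → eq }
... | true = _ , there (here refl) , λ { [] → eq }
allSubsets-complete (suc n) S
  with allSubsets-complete n (S ∘ (false ∷_)) | allSubsets-complete n (S ∘ (true ∷_))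
... | S₀ , S₀∈ , eq₀ | S₁ , S₁∈ , eq₁ =
  _ , ∈-concatMap⁺ _ (Any.map (λ { refl → ∈-map⁺ _ S₁∈ }) S₀∈) ,
  λ { (false ∷ x) → eq₀ x ; (true ∷ x) → eq₁ x }

∈⇒≤max : ∀ {A : Set} (f : A → ℕ) {x xs} → x ∈ xs → f x ≤ foldr _⊔_ 0 (map f xs)
∈⇒≤max f {xs = y ∷ xs} (here refl) = m≤m⊔n (f y) _
∈⇒≤max f {xs = y ∷ xs} (there x∈) = ≤-trans (∈⇒≤max f x∈) (m≤n⊔m (f y) _)

*max≤ : ∀ {A : Set} k (f : A → ℕ) {m} → (∀ x → k * f x ≤ m) → ∀ xs → k * foldr _⊔_ 0 (map f xs) ≤ m
*max≤ k f kf≤m [] = ≤-trans (≤-reflexive (*-zeroʳ k)) z≤n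
*max≤ k f kf≤m (x ∷ xs) =
  ≤-trans (≤-reflexive (*-distribˡ-⊔ k (f x) _)) (⊔-lub (kf≤m x) (*max≤ k f kf≤m xs))

ΛS-cong : ∀ {n} {S S′ : Subset n} d s → S ≗ S′ → ΛS S d s ≡ ΛS S′ d s
ΛS-cong {S = S} {S′} d s S≗S′ = trans (ΛS≡cubes S d s)
  (trans (sumC-cong λ C → cong (λ m → 𝟙 ((dim C ≡ᵇ d) ∧ (m ≡ᵇ s))) (cubeSum-cong (cong 𝟙 ∘ S≗S′) C))
    (sym (ΛS≡cubes S′ d s)))

ΛS≤Λ : ∀ {n} (S : Subset n) d s → ΛS S d s ≤ Λ n d s
ΛS≤Λ {n} S d s with allSubsets-complete n S
... | S′ , S′∈ , S≗S′ =
  ≤-trans (≤-reflexive (ΛS-cong d s S≗S′)) (∈⇒≤max (λ S → ΛS S d s) S′∈)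

-- Pascal's rule: the first coordinate is free, or it is fixed in one of two ways.
numCubes-suc : ∀ n d → numCubes (suc n) (suc d) ≡ numCubes n d + 2 * numCubes n (suc d)
numCubes-suc n d = trans (cong (_* 2 ^ (n ∸ d)) (sym (Comb.nCk+nC[k+1]≡[n+1]C[k+1] n d)))
  (trans (*-distribʳ-+ (2 ^ (n ∸ d)) (n Comb.C d) (n Comb.C suc d)) (cong (numCubes n d +_) second))
  where
  second : (n Comb.C suc d) * 2 ^ (n ∸ d) ≡ 2 * numCubes n (suc d)
  second with suc d ≤? n
  ... | yes d<n = trans (cong (λ m → (n Comb.C suc d) * 2 ^ m) (+-∸-assoc 1 d<n)) (comm (n Comb.C suc d) (2 ^ (n ∸ suc d)))
    where
    comm : ∀ a b → a * (2 * b) ≡ 2 * (a * b)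
    comm = solve-∀
  -- Truncated subtraction spoils the exponent rule when `n ≤ d`, but then the binomial coefficient
  -- is `0`.
  ... | no d≮n rewrite Comb.k>n⇒nCk≡0 (≰⇒> d≮n) = refl

numCubes-zero : ∀ n → numCubes (suc n) 0 ≡ 2 * numCubes n 0
numCubes-zero n = trans (*-identityˡ (2 ^ suc n)) (cong (2 *_) (sym (*-identityˡ (2 ^ n))))

-- Linear colourings.

every : ∀ k → (Vec Bool k → Bool) → Bool
every zero p = p []
every (suc k) p = every k (p ∘ (false ∷_)) ∧ every k (p ∘ (true ∷_))

every-sound : ∀ k (p : Vec Bool k → Bool) → every k p ≡ true → ∀ v → p v ≡ true
every-sound zero p eq [] = eq
every-sound (suc k) p eq (b ∷ v)
  with every k (p ∘ (false ∷_)) in e₀ | every k (p ∘ (true ∷_)) in e₁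
every-sound (suc k) p eq (false ∷ v) | true | true = every-sound k (p ∘ (false ∷_)) e₀ v
every-sound (suc k) p eq (true ∷ v) | true | true = every-sound k (p ∘ (true ∷_)) e₁ v

isZero : ∀ {k} → Vec Bool k → Bool
isZero [] = true
isZero (b ∷ v) = not b ∧ isZero v

_⊕_ : ∀ {k} → Vec Bool k → Vec Bool k → Vec Bool k
_⊕_ = zipWith _xor_

⊕-right-comm : ∀ {k} (v w w′ : Vec Bool k) → (v ⊕ w) ⊕ w′ ≡ (v ⊕ w′) ⊕ w
⊕-right-comm [] [] [] = refl
⊕-right-comm (a ∷ v) (b ∷ w) (c ∷ w′) = cong₂ _∷_
  (trans (xor-assoc a b c) (trans (cong (a xor_) (xor-comm b c)) (sym (xor-assoc a c b))))
  (⊕-right-comm v w w′)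

-- This is `g` at `v ⊕ ∑ xᵢcᵢ`; the accumulator `v` holds the contribution of the coordinates
-- already read.
pullback : ∀ {k n} {X : Set} → Vec (Vec Bool k) n → (Vec Bool k → X) → Vec Bool k → Vertex n → X
pullback [] g v [] = g v
pullback (w ∷ c) g v (false ∷ x) = pullback c g v x
pullback (w ∷ c) g v (true ∷ x) = pullback c g (v ⊕ w) x

pullback-∘ : ∀ {k n} {X Y : Set} (h : X → Y) (c : Vec (Vec Bool k) n) g v →
             h ∘ pullback c g v ≗ pullback c (h ∘ g) v
pullback-∘ h [] g v [] = refl
pullback-∘ h (w ∷ c) g v (false ∷ x) = pullback-∘ h c g v x
pullback-∘ h (w ∷ c) g v (true ∷ x) = pullback-∘ h c g (v ⊕ w) x

shift : ∀ {k} → Vec Bool k → (Vec Bool k → ℕ) → Vec Bool k → ℕ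
shift w g v = g v + g (v ⊕ w)

pullback-shift : ∀ {k n} (c : Vec (Vec Bool k) n) w g v x →
  pullback c g v x + pullback c g (v ⊕ w) x ≡ pullback c (shift w g) v x
pullback-shift [] w g v [] = refl
pullback-shift (w′ ∷ c) w g v (false ∷ x) = pullback-shift c w g v x
pullback-shift (w′ ∷ c) w g v (true ∷ x) = trans
  (cong (λ v′ → pullback c g (v ⊕ w′) x + pullback c g v′ x) (⊕-right-comm v w w′))
  (pullback-shift c w g (v ⊕ w′) x)

-- The value at `v` is the sum of `g` over `v` plus all subset sums of the colours at free
-- coordinates. Fixed coordinates of the cube only move `v`.
shifts : ∀ {k n} → Vec (Vec Bool k) n → Cube n → (Vec Bool k → ℕ) → Vec Bool k → ℕ
shifts [] [] g = g
shifts (w ∷ c) (nothing ∷ C) g = shifts c C (shift w g)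
shifts (w ∷ c) (just _ ∷ C) g = shifts c C g

𝟙-∧-mono : ∀ a {b b′} → (b ≡ true → b′ ≡ true) → 𝟙 (a ∧ b) ≤ 𝟙 (a ∧ b′)
𝟙-∧-mono false imp = z≤n
𝟙-∧-mono true {false} imp = z≤n
𝟙-∧-mono true {true} imp rewrite imp refl = ≤-refl

module Colouring {k κ : ℕ} (colour : Fin κ → Vec Bool k) (s : ℕ) where

  -- Asking for every `v` makes the condition independent of the fixed coordinates. For `𝟙 ∘ isZero`
  -- shifted by `d` colours it says that every vector is a subset sum exactly `s` times; when `s` is
  -- `2^(d−k)`, this means that the colours span.
  good : (Vec Bool k → ℕ) → Bool
  good g = every k λ v → g v ≡ᵇ s

  good⇒cubeSum : ∀ {n} (c : Vec (Vec Bool k) n) C g → good (shifts c C g) ≡ true →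
                 ∀ v → (cubeSum (pullback c g v) C ≡ᵇ s) ≡ true
  good⇒cubeSum [] [] g ok v = every-sound k (λ v → g v ≡ᵇ s) ok v
  good⇒cubeSum (w ∷ c) (nothing ∷ C) g ok v =
    trans (cong (_≡ᵇ s) (cubeSum-cong (pullback-shift c w g v) C)) (good⇒cubeSum c C (shift w g) ok v)
  good⇒cubeSum (w ∷ c) (just false ∷ C) g ok v = good⇒cubeSum c C g ok v
  good⇒cubeSum (w ∷ c) (just true ∷ C) g ok v = good⇒cubeSum c C g ok (v ⊕ w)

  goodCubes : ∀ {n} → ℕ → (Vec Bool k → ℕ) → Vec (Vec Bool k) n → ℕ
  goodCubes d g c = sumC λ C → 𝟙 ((dim C ≡ᵇ d) ∧ good (shifts c C g))

  goodCubes≤Λ : ∀ {n} d (c : Vec (Vec Bool k) n) → goodCubes d (𝟙 ∘ isZero) c ≤ Λ n d s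
  goodCubes≤Λ {n} d c = begin
    goodCubes d (𝟙 ∘ isZero) c
      ≤⟨ sumC-mono (λ C → 𝟙-∧-mono (dim C ≡ᵇ d) λ ok → good⇒cubeSum c C (𝟙 ∘ isZero) ok v₀) ⟩
    cubes s d (pullback c (𝟙 ∘ isZero) v₀)
      ≡⟨ sumC-cong (λ C → cong (λ m → 𝟙 ((dim C ≡ᵇ d) ∧ (m ≡ᵇ s))) (cubeSum-cong (pullback-∘ 𝟙 c isZero v₀) C)) ⟨
    cubes s d (𝟙 ∘ pullback c isZero v₀)
      ≡⟨ ΛS≡cubes (pullback c isZero v₀) d s ⟨
    ΛS (pullback c isZero v₀) d s
      ≤⟨ ΛS≤Λ (pullback c isZero v₀) d s ⟩
    Λ n d s ∎
    where
    open ≤-Reasoning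
    v₀ : Vec Bool k
    v₀ = replicate k false

  sumCol : ∀ n → (Vec (Vec Bool k) n → ℕ) → ℕ
  sumCol zero h = h []
  sumCol (suc n) h = sum λ i → sumCol n λ c → h (colour i ∷ c)

  sumCol-cong : ∀ n {h h′ : Vec (Vec Bool k) n → ℕ} → h ≗ h′ → sumCol n h ≡ sumCol n h′
  sumCol-cong zero eq = eq []
  sumCol-cong (suc n) eq = sum-cong-≗ λ i → sumCol-cong n (eq ∘ (colour i ∷_))

  sumCol-+ : ∀ n (h h′ : Vec (Vec Bool k) n → ℕ) →
             sumCol n (λ c → h c + h′ c) ≡ sumCol n h + sumCol n h′
  sumCol-+ zero h h′ = refl
  sumCol-+ (suc n) h h′ = trans
    (sum-cong-≗ λ i → sumCol-+ n (h ∘ (colour i ∷_)) (h′ ∘ (colour i ∷_)))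
    (∑-distrib-+ (λ i → sumCol n (h ∘ (colour i ∷_))) (λ i → sumCol n (h′ ∘ (colour i ∷_))))

  sumCol-≤ : ∀ n {h : Vec (Vec Bool k) n → ℕ} {m} → (∀ c → h c ≤ m) → sumCol n h ≤ κ ^ n * m
  sumCol-≤ zero {m = m} h≤m = ≤-trans (h≤m []) (≤-reflexive (sym (*-identityˡ m)))
  sumCol-≤ (suc n) {m = m} h≤m = ≤-trans (sum-mono λ i → sumCol-≤ n (h≤m ∘ (colour i ∷_)))
    (≤-reflexive (trans (sum-const κ (κ ^ n * m)) (sym (*-assoc κ (κ ^ n) m))))

  goodTuples : ℕ → (Vec Bool k → ℕ) → ℕ
  goodTuples zero g = 𝟙 (good g)
  goodTuples (suc d) g = sum λ i → goodTuples d (shift (colour i) g)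

  -- As the colouring varies, the free coordinates of a fixed `d`-subcube receive each colour tuple
  -- equally often. The factor `κ ^ d` on the left avoids the exponent `n ∸ d` on the right.
  total-good : ∀ n d g →
    sumCol n (goodCubes d g) * κ ^ d ≡ κ ^ n * (numCubes n d * goodTuples d g)
  total-good zero zero g = arith (goodTuples 0 g)
    where
    arith : ∀ a → a * 1 ≡ 1 * (1 * a)
    arith = solve-∀
  total-good zero (suc d) g = refl
  total-good (suc n) zero g = begin
    sumCol (suc n) (goodCubes 0 g) * 1
      ≡⟨ cong (_* 1) (sum-cong-≗ {κ} λ i → trans
           (sumCol-cong n λ c → cong (_+ (goodCubes 0 g c + goodCubes 0 g c)) (sumC-zero n))
           (sumCol-+ n (goodCubes 0 g) (goodCubes 0 g))) ⟩
    sum {κ} (λ _ → A + A) * 1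
      ≡⟨ cong (_* 1) (sum-const κ (A + A)) ⟩
    κ * (A + A) * 1
      ≡⟨ arith₁ κ A ⟩
    2 * κ * (A * 1)
      ≡⟨ cong (2 * κ *_) (total-good n zero g) ⟩
    2 * κ * (κ ^ n * (numCubes n 0 * goodTuples 0 g))
      ≡⟨ arith₂ κ (κ ^ n) (numCubes n 0) (goodTuples 0 g) ⟩
    κ * κ ^ n * (2 * numCubes n 0 * goodTuples 0 g)
      ≡⟨ cong (λ m → κ * κ ^ n * (m * goodTuples 0 g)) (numCubes-zero n) ⟨
    κ ^ suc n * (numCubes (suc n) 0 * goodTuples 0 g) ∎
    where
    open ≡-Reasoning
    A = sumCol n (goodCubes 0 g)
    arith₁ : ∀ a b → a * (b + b) * 1 ≡ 2 * a * (b * 1)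
    arith₁ = solve-∀
    arith₂ : ∀ a b c e → 2 * a * (b * (c * e)) ≡ a * b * (2 * c * e)
    arith₂ = solve-∀
  total-good (suc n) (suc d) g = begin
    sumCol (suc n) (goodCubes (suc d) g) * (κ * κ ^ d)
      ≡⟨ cong (_* (κ * κ ^ d)) split ⟩
    (sum A + κ * (B + B)) * (κ * κ ^ d)
      ≡⟨ arith₁ (sum A) κ B (κ ^ d) ⟩
    κ * (κ ^ d * sum A) + 2 * κ * (B * (κ * κ ^ d))
      ≡⟨ cong₂ (λ a b → κ * a + 2 * κ * b) sumA (total-good n (suc d) g) ⟩
    κ * (κ ^ n * (numCubes n d * goodTuples (suc d) g)) +
    2 * κ * (κ ^ n * (numCubes n (suc d) * goodTuples (suc d) g))
      ≡⟨ arith₂ κ (κ ^ n) (numCubes n d) (numCubes n (suc d)) (goodTuples (suc d) g) ⟩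
    κ * κ ^ n * ((numCubes n d + 2 * numCubes n (suc d)) * goodTuples (suc d) g)
      ≡⟨ cong (λ m → κ * κ ^ n * (m * goodTuples (suc d) g)) (numCubes-suc n d) ⟨
    κ ^ suc n * (numCubes (suc n) (suc d) * goodTuples (suc d) g) ∎
    where
    open ≡-Reasoning
    A : Fin κ → ℕ
    A i = sumCol n (goodCubes d (shift (colour i) g))
    B : ℕ
    B = sumCol n (goodCubes (suc d) g)
    split : sumCol (suc n) (goodCubes (suc d) g) ≡ sum A + κ * (B + B)
    split = begin
      sumCol (suc n) (goodCubes (suc d) g)
        ≡⟨ sum-cong-≗ (λ i → trans (sumCol-+ n (goodCubes d (shift (colour i) g)) _)
             (cong (A i +_) (sumCol-+ n (goodCubes (suc d) g) (goodCubes (suc d) g)))) ⟩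
      sum (λ i → A i + (B + B))
        ≡⟨ ∑-distrib-+ A (λ _ → B + B) ⟩
      sum A + sum {κ} (λ _ → B + B)
        ≡⟨ cong (sum A +_) (sum-const κ (B + B)) ⟩
      sum A + κ * (B + B) ∎
    sumA : κ ^ d * sum A ≡ κ ^ n * (numCubes n d * goodTuples (suc d) g)
    sumA = begin
      κ ^ d * sum A
        ≡⟨ sum-distribˡ (κ ^ d) A ⟨
      sum (λ i → κ ^ d * A i)
        ≡⟨ sum-cong-≗ (λ i → trans (*-comm (κ ^ d) (A i)) (trans (total-good n d (shift (colour i) g))
             (sym (*-assoc (κ ^ n) (numCubes n d) _)))) ⟩
      sum (λ i → κ ^ n * numCubes n d * goodTuples d (shift (colour i) g))
        ≡⟨ sum-distribˡ (κ ^ n * numCubes n d) (λ i → goodTuples d (shift (colour i) g)) ⟩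
      κ ^ n * numCubes n d * goodTuples (suc d) g
        ≡⟨ *-assoc (κ ^ n) (numCubes n d) _ ⟩
      κ ^ n * (numCubes n d * goodTuples (suc d) g) ∎
    arith₁ : ∀ a b c e → (a + b * (c + c)) * (b * e) ≡ b * (e * a) + 2 * b * (c * (b * e))
    arith₁ = solve-∀
    arith₂ : ∀ a b c e f → a * (b * (c * f)) + 2 * a * (b * (e * f)) ≡ a * b * ((c + 2 * e) * f)
    arith₂ = solve-∀

  -- Each colouring gives at most `Λ n d s` good cubes, so the average over all colourings obeys the
  -- same bound.
  lower-bound : .{{_ : NonZero κ}} → ∀ n d →
                goodTuples d (𝟙 ∘ isZero) * numCubes n d ≤ κ ^ d * Λ n d s
  lower-bound n d = *-cancelˡ-≤ (κ ^ n) {{m^n≢0 κ n}} (begin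
    κ ^ n * (goodTuples d (𝟙 ∘ isZero) * numCubes n d)
      ≡⟨ cong (κ ^ n *_) (*-comm (goodTuples d (𝟙 ∘ isZero)) (numCubes n d)) ⟩
    κ ^ n * (numCubes n d * goodTuples d (𝟙 ∘ isZero))
      ≡⟨ total-good n d (𝟙 ∘ isZero) ⟨
    sumCol n (goodCubes d (𝟙 ∘ isZero)) * κ ^ d
      ≤⟨ *-monoˡ-≤ (κ ^ d) (sumCol-≤ n (goodCubes≤Λ d)) ⟩
    κ ^ n * Λ n d s * κ ^ d
      ≡⟨ *-assoc (κ ^ n) (Λ n d s) (κ ^ d) ⟩
    κ ^ n * (Λ n d s * κ ^ d)
      ≡⟨ cong (κ ^ n *_) (*-comm (Λ n d s) (κ ^ d)) ⟩
    κ ^ n * (κ ^ d * Λ n d s) ∎)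
    where open ≤-Reasoning

-- `drop 1` removes the zero vector, which `allVecs` lists first.
nonzero₂ : Fin 3 → Vec Bool 2
nonzero₂ = List.lookup (List.drop 1 (allVecs 2))

nonzero₃ : Fin 7 → Vec Bool 3
nonzero₃ = List.lookup (List.drop 1 (allVecs 3))

lower₃₂ : ∀ n → 8 * numCubes n 3 ≤ 9 * Λ n 3 2
-- `goodTuples` evaluates to `24` out of `3 ^ 3`, and the common factor is cancelled. The two bounds
-- below use `78` out of `3 ^ 4` and `1848` out of `7 ^ 4`.
lower₃₂ n = *-cancelˡ-≤ 3 (subst₂ _≤_ (*-assoc 3 8 (numCubes n 3)) (*-assoc 3 9 (Λ n 3 2))
  (Colouring.lower-bound nonzero₂ 2 n 3))

lower₄₄ : ∀ n → 26 * numCubes n 4 ≤ 27 * Λ n 4 4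
lower₄₄ n = *-cancelˡ-≤ 3 (subst₂ _≤_ (*-assoc 3 26 (numCubes n 4)) (*-assoc 3 27 (Λ n 4 4))
  (Colouring.lower-bound nonzero₂ 4 n 4))

lower₄₂ : ∀ n → 264 * numCubes n 4 ≤ 343 * Λ n 4 2
lower₄₂ n = *-cancelˡ-≤ 7 (subst₂ _≤_ (*-assoc 7 264 (numCubes n 4)) (*-assoc 7 343 (Λ n 4 2))
  (Colouring.lower-bound nonzero₃ 2 n 4))

open import Data.Integer using (ℤ; +_; +[1+_]; -[1+_]; -_; ∣_∣)
import Data.Integer as ℤ
import Data.Integer.Properties as ℤₚ
import Algebra.Properties.Semiring.Sum ℤₚ.+-*-semiring as ℤΣ
open import Data.Rational using (mkℚ; _/_; toℚᵘ)
import Data.Rational as ℚ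
import Data.Rational.Properties as ℚₚ
open import Data.Rational.Unnormalised using (mkℚᵘ; *<*)
import Data.Rational.Unnormalised as ℚᵘ
import Data.Rational.Unnormalised.Properties as ℚᵘₚ

-- Sums of squares

pos-sum : ∀ {n} (f : Fin n → ℕ) → + sum f ≡ ℤΣ.sum (λ i → + f i)
pos-sum {zero} f = refl
pos-sum {suc n} f = trans (ℤₚ.pos-+ (f zero) (sum (f ∘ suc))) (cong (ℤ._+_ (+ f zero)) (pos-sum (f ∘ suc)))

0≤square : ∀ i → ℤ.0ℤ ℤ.≤ i ℤ.* i
0≤square (+ n) = subst (ℤ.0ℤ ℤ.≤_) (ℤₚ.pos-* n n) (ℤ.+≤+ z≤n)
0≤square ℤ.-[1+ n ] = ℤ.+≤+ z≤n

-- An entry (k , w) stands for k · w².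
Squares : Set → Set
Squares A = List (ℕ × (A → ℤ))

bilinear : ∀ {A : Set} → Squares A → A → A → ℤ
bilinear ws b e = foldr (λ (k , w) r → + k ℤ.* (w b ℤ.* w e) ℤ.+ r) ℤ.0ℤ ws

sum-square : ∀ {n} k (u : Fin n → ℤ) →
  ℤΣ.sum (λ j → ℤΣ.sum λ l → k ℤ.* (u j ℤ.* u l)) ≡ k ℤ.* (ℤΣ.sum u ℤ.* ℤΣ.sum u)
sum-square k u = sym (begin
  k ℤ.* (ℤΣ.sum u ℤ.* ℤΣ.sum u)
    ≡⟨ cong (k ℤ.*_) (ℤΣ.*-distribʳ-sum (ℤΣ.sum u) u) ⟩
  k ℤ.* ℤΣ.sum (λ j → u j ℤ.* ℤΣ.sum u)
    ≡⟨ ℤΣ.*-distribˡ-sum k (λ j → u j ℤ.* ℤΣ.sum u) ⟩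
  ℤΣ.sum (λ j → k ℤ.* (u j ℤ.* ℤΣ.sum u))
    ≡⟨ ℤΣ.sum-cong-≗ (λ j → trans (cong (k ℤ.*_) (ℤΣ.*-distribˡ-sum (u j) u))
         (ℤΣ.*-distribˡ-sum k (λ l → u j ℤ.* u l))) ⟩
  ℤΣ.sum (λ j → ℤΣ.sum λ l → k ℤ.* (u j ℤ.* u l)) ∎)
  where open ≡-Reasoning

ℤ∑∑-distrib-+ : ∀ {n} (f g : Fin n → Fin n → ℤ) →
  ℤΣ.sum (λ j → ℤΣ.sum λ l → f j l ℤ.+ g j l) ≡
  ℤΣ.sum (λ j → ℤΣ.sum (f j)) ℤ.+ ℤΣ.sum (λ j → ℤΣ.sum (g j))
ℤ∑∑-distrib-+ f g = trans (ℤΣ.sum-cong-≗ λ j → ℤΣ.∑-distrib-+ (f j) (g j))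
  (ℤΣ.∑-distrib-+ (λ j → ℤΣ.sum (f j)) (λ j → ℤΣ.sum (g j)))

-- Single values of `bilinear` may be negative, but the double sum of each term is `k` times the
-- square of a sum.
0≤∑∑bilinear : ∀ {A : Set} {n} (ws : Squares A) (b : Fin n → A) →
               ℤ.0ℤ ℤ.≤ ℤΣ.sum (λ j → ℤΣ.sum λ l → bilinear ws (b j) (b l))
0≤∑∑bilinear {n = n} [] b = ℤₚ.≤-reflexive (sym (trans
  (ℤΣ.sum-cong-≗ {n} λ j → ℤΣ.sum-replicate-zero n) (ℤΣ.sum-replicate-zero n)))
0≤∑∑bilinear ((k , w) ∷ ws) b = begin
  ℤ.0ℤ
    ≤⟨ ℤₚ.+-mono-≤ 0≤head (0≤∑∑bilinear ws b) ⟩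
  + k ℤ.* (ℤΣ.sum (w ∘ b) ℤ.* ℤΣ.sum (w ∘ b)) ℤ.+ ℤΣ.sum (λ j → ℤΣ.sum λ l → bilinear ws (b j) (b l))
    ≡⟨ cong (ℤ._+ _) (sum-square (+ k) (w ∘ b)) ⟨
  ℤΣ.sum (λ j → ℤΣ.sum λ l → + k ℤ.* (w (b j) ℤ.* w (b l))) ℤ.+
  ℤΣ.sum (λ j → ℤΣ.sum λ l → bilinear ws (b j) (b l))
    ≡⟨ ℤ∑∑-distrib-+ (λ j l → + k ℤ.* (w (b j) ℤ.* w (b l))) (λ j l → bilinear ws (b j) (b l)) ⟨
  ℤΣ.sum (λ j → ℤΣ.sum λ l → bilinear ((k , w) ∷ ws) (b j) (b l)) ∎
  where
  open ℤₚ.≤-Reasoning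
  0≤head : ℤ.0ℤ ℤ.≤ + k ℤ.* (ℤΣ.sum (w ∘ b) ℤ.* ℤΣ.sum (w ∘ b))
  0≤head = subst (ℤ._≤ + k ℤ.* (ℤΣ.sum (w ∘ b) ℤ.* ℤΣ.sum (w ∘ b))) (ℤₚ.*-zeroʳ (+ k))
    (ℤₚ.*-monoˡ-≤-nonNeg (+ k) (0≤square (ℤΣ.sum (w ∘ b))))

-- The offset `c` lets `q` take values in `ℕ`, as `T` requires; what exceeds it is a nonnegative
-- double sum.
const≤∑∑ : ∀ {A : Set} {n} c (ws : Squares A) (q : A → A → ℕ) →
  (∀ b e → + q b e ≡ + c ℤ.+ bilinear ws b e) → (b : Fin n → A) →
  sum {n} (λ j → sum {n} λ l → c) ≤ sum (λ j → sum λ l → q (b j) (b l))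
const≤∑∑ {n = n} c ws q q≡ b = ℤₚ.drop‿+≤+ (begin
  + sum {n} (λ j → sum {n} λ l → c)
    ≡⟨ pos² (λ _ _ → c) ⟩
  ℤΣ.sum {n} (λ j → ℤΣ.sum {n} λ l → + c)
    ≡⟨ ℤₚ.+-identityʳ _ ⟨
  ℤΣ.sum {n} (λ j → ℤΣ.sum {n} λ l → + c) ℤ.+ ℤ.0ℤ
    ≤⟨ ℤₚ.+-monoʳ-≤ (ℤΣ.sum {n} (λ j → ℤΣ.sum {n} λ l → + c)) (0≤∑∑bilinear ws b) ⟩
  ℤΣ.sum {n} (λ j → ℤΣ.sum {n} λ l → + c) ℤ.+ ℤΣ.sum (λ j → ℤΣ.sum λ l → bilinear ws (b j) (b l))
    ≡⟨ ℤ∑∑-distrib-+ (λ _ _ → + c) (λ j l → bilinear ws (b j) (b l)) ⟨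
  ℤΣ.sum (λ j → ℤΣ.sum λ l → + c ℤ.+ bilinear ws (b j) (b l))
    ≡⟨ ℤΣ.sum-cong-≗ (λ j → ℤΣ.sum-cong-≗ λ l → q≡ (b j) (b l)) ⟨
  ℤΣ.sum (λ j → ℤΣ.sum λ l → + q (b j) (b l))
    ≡⟨ pos² (λ j l → q (b j) (b l)) ⟨
  + sum (λ j → sum λ l → q (b j) (b l)) ∎)
  where
  open ℤₚ.≤-Reasoning
  pos² : (f : Fin n → Fin n → ℕ) → + sum (λ j → sum (f j)) ≡ ℤΣ.sum λ j → ℤΣ.sum λ l → + f j l
  pos² f = trans (pos-sum (λ j → sum (f j))) (ℤΣ.sum-cong-≗ λ j → pos-sum (f j))

-- Lower bounds for averages over cubes.

record AvgAtLeast (d : ℕ) {A : Set} (c : ℕ) (h : Pow d A → ℕ) : Set where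
  field bound : ∀ {n} (f : Vertex n → A) → T d (λ _ → c) f ≤ T d h f
open AvgAtLeast

avg-cong : ∀ d {A : Set} {c} {h k : Pow d A → ℕ} → h ≗ k → AvgAtLeast d c h → AvgAtLeast d c k
avg-cong d h≗k lb .bound f = ≤-trans (lb .bound f) (T-mono d (≤-reflexive ∘ h≗k) f)

avg-sym : ∀ d {A : Set} {c} {h : Pow d A → ℕ} {γ} →
          Symmetry d {A} γ → AvgAtLeast d c h → AvgAtLeast d c (h ∘ γ)
avg-sym d {h = h} s lb .bound f = ≤-trans (lb .bound f) (≤-reflexive (sym (s .invariant h f)))

avg-+ : ∀ d {A : Set} {c c′} {h k : Pow d A → ℕ} →
        AvgAtLeast d c h → AvgAtLeast d c′ k → AvgAtLeast d (c + c′) (λ φ → h φ + k φ)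
avg-+ d {c = c} {c′} {h} {k} lb lb′ .bound f = begin
  T d (λ _ → c + c′) f               ≡⟨ T-+ d (λ _ → c) (λ _ → c′) f ⟩
  T d (λ _ → c) f + T d (λ _ → c′) f ≤⟨ +-mono-≤ (lb .bound f) (lb′ .bound f) ⟩
  T d h f + T d k f                  ≡⟨ T-+ d h k f ⟨
  T d (λ φ → h φ + k φ) f ∎
  where open ≤-Reasoning

-- For a fixed first direction, a cube is a smaller cube labelled by edges. Iterated, this turns a
-- bound for squares with labels in `Q k`, that is for `k`-faces and two further directions, into
-- one for `(2 + k)`-cubes.
avg-lift : ∀ d {A : Set} {c} {h : Pow d (A × A) → ℕ} → AvgAtLeast d {A × A} c h → AvgAtLeast (suc d) {A} c h
avg-lift d lb .bound f = sum-mono λ i → lb .bound (D i f)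

corner : ∀ {A : Set} → (A → A → A → ℕ) → (A × A) × (A × A) → ℕ
corner q ((a , b) , (e , _)) = q a b e

-- For fixed x the sum over the two directions is a sum of squares; repeated directions
-- make it exact rather than asymptotic.
avg-corner : ∀ {A : Set} c (cert : A → Squares A) (q : A → A → A → ℕ) →
  (∀ a b e → + q a b e ≡ + c ℤ.+ bilinear (cert a) b e) → AvgAtLeast 2 c (corner q)
avg-corner {A} c cert q q≡ .bound {n} f = begin
  sum {n} (λ j → sum {n} λ l → sumV {n} λ x → c)
    ≡⟨ exchange (λ _ _ _ → c) ⟩
  sumV {n} (λ x → sum {n} λ j → sum {n} λ l → c)
    ≤⟨ sumV-mono (λ x → const≤∑∑ c (cert (f x)) (q (f x)) (q≡ (f x)) (λ j → f (flip j x))) ⟩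
  sumV (λ x → sum λ j → sum λ l → q (f x) (f (flip j x)) (f (flip l x)))
    ≡⟨ exchange (λ x j l → q (f x) (f (flip j x)) (f (flip l x))) ⟨
  sum (λ j → sum λ l → sumV λ x → q (f x) (f (flip j x)) (f (flip l x))) ∎
  where
  open ≤-Reasoning
  exchange : (g : Vertex n → Fin n → Fin n → ℕ) →
    sum (λ j → sum λ l → sumV λ x → g x j l) ≡ sumV λ x → sum λ j → sum λ l → g x j l
  exchange g = trans (sum-cong-≗ λ j → sumV-∑-comm λ x l → g x j l) (sumV-∑-comm λ x j → sum (g x j))

-- Each of the four parallel faces serves once as the base.
reflections : ∀ {A : Set} → ((A × A) × (A × A) → ℕ) → (A × A) × (A × A) → ℕ
reflections h φ = (h φ + h (pair swap φ)) + (h (swap φ) + h (pair swap (swap φ)))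

avg-reflections : ∀ {A : Set} {c} {h : (A × A) × (A × A) → ℕ} →
                  AvgAtLeast 2 c h → AvgAtLeast 2 ((c + c) + (c + c)) (reflections h)
avg-reflections {c = c} {h} lb = avg-+ 2 lb₁ (avg-sym 2 (lift-sym 1 (reflect-sym 0)) lb₁)
  where
  lb₁ : AvgAtLeast 2 (c + c) (λ φ → h φ + h (pair swap φ))
  lb₁ = avg-+ 2 lb (avg-sym 2 (reflect-sym 1) lb)

-- Exhaustive evaluation over labellings.

-- For a numeral `k` this computes to the same type as `Pow k Bool`; splitting the outermost pair
-- first suits recursion over labellings.
Q : ℕ → Set
Q zero = Bool
Q (suc k) = Q k × Q k

-- Memo tables are shared during evaluation, which keeps the check over all 2¹⁶ labellings feasible.
Memo : ℕ → Set → Set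
Memo zero X = X × X
Memo (suc k) X = Memo k (Memo k X)

tabulate : ∀ k {X : Set} → (Q k → X) → Memo k X
tabulate zero f = f false , f true
tabulate (suc k) f = tabulate k λ a → tabulate k λ b → f (a , b)

lookup : ∀ k {X : Set} → Memo k X → Q k → X
lookup zero (x , y) false = x
lookup zero (x , y) true = y
lookup (suc k) t (a , b) = lookup k (lookup k t a) b

lookup-tabulate : ∀ k {X : Set} (f : Q k → X) → lookup k (tabulate k f) ≗ f
lookup-tabulate zero f false = refl
lookup-tabulate zero f true = refl
lookup-tabulate (suc k) f (a , b) = trans
  (cong (λ t → lookup k t b) (lookup-tabulate k (λ a → tabulate k λ b → f (a , b)) a))
  (lookup-tabulate k (λ b → f (a , b)) b)

all : ∀ k → (Q k → Bool) → Bool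
all zero p = p false ∧ p true
all (suc k) p = all k λ a → all k λ b → p (a , b)

all-sound : ∀ k (p : Q k → Bool) → all k p ≡ true → ∀ a → p a ≡ true
all-sound zero p eq a with p false in e₀ | p true in e₁
all-sound zero p eq false | true | true = e₀
all-sound zero p eq true | true | true = e₁
all-sound (suc k) p eq (a , b) =
  all-sound k (λ b → p (a , b)) (all-sound k (λ a → all k λ b → p (a , b)) eq a) b

Table : ℕ → Set
Table k = Memo k (Memo k (Memo k ℕ))

module Certificate (k c : ℕ) (cert : Q k → Squares (Q k)) where

  value : Q k → Q k → Q k → ℤ
  value a b e = + c ℤ.+ bilinear (cert a) b e

  -- The absolute value makes the entries natural numbers and changes nothing once `nonNegative` has
  -- been checked.
  table : Table k
  table = tabulate k λ a → tabulate k λ b → tabulate k λ e → ∣ value a b e ∣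

  entry : Table k → Q k → Q k → Q k → ℕ
  entry t a b e = lookup k (lookup k (lookup k t a) b) e

  nonNegative : Bool
  nonNegative = all k λ a → all k λ b → all k λ e → ℤ.0ℤ ℤ.≤ᵇ value a b e

  entry≡ : nonNegative ≡ true → ∀ a b e → + entry table a b e ≡ value a b e
  entry≡ nn a b e = trans (cong +_ look) (ℤₚ.0≤i⇒+∣i∣≡i (ℤₚ.≤ᵇ⇒≤ (Equivalence.from T-≡ 0≤)))
    where
    0≤ : (ℤ.0ℤ ℤ.≤ᵇ value a b e) ≡ true
    0≤ = all-sound k _ (all-sound k _ (all-sound k _ nn a) b) e
    look : entry table a b e ≡ ∣ value a b e ∣
    look = trans (cong (λ t → lookup k (lookup k t b) e) (lookup-tabulate k _ a))
      (trans (cong (λ t → lookup k t e) (lookup-tabulate k _ b)) (lookup-tabulate k _ e))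

  faces : Table k → Memo (2 + k) ℕ
  faces t = tabulate (2 + k) (reflections (corner (entry t)))

  avg-faces : nonNegative ≡ true →
              AvgAtLeast 2 {Q k} ((c + c) + (c + c)) (lookup (2 + k) (faces table))
  avg-faces nn = avg-cong 2
    (λ φ → sym (lookup-tabulate (2 + k) (reflections (corner (entry table))) φ))
    (avg-reflections (avg-corner c cert (entry table) (entry≡ nn)))

-- Upper bounds

points : ∀ d → Pow d Bool → ℕ
points d = total d ∘ mapPow d 𝟙

-- Sum the pointwise inequality over all tuples: `m` averages at least `c`, so the two cancel and
-- the hits have density at most `num / den`. The scale `K` keeps the weights integral.
upper-bound : ∀ d s K num den {c} {m : Pow d Bool → ℕ} .{{_ : NonZero K}} → AvgAtLeast d c m →
  (∀ φ → K * den * 𝟙 (points d φ ≡ᵇ s) + m φ ≤ K * num + c) →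
  ∀ {n} (S : Subset n) → den * (d ! * 2 ^ d * ΛS S d s) ≤ num * (n ^ d * 2 ^ n)
upper-bound d s K num den {c} {m} lb pointwise {n} S = *-cancelˡ-≤ K (begin
  K * (den * (d ! * 2 ^ d * ΛS S d s))
    ≡⟨ *-assoc K den _ ⟨
  K * den * (d ! * 2 ^ d * ΛS S d s)
    ≡⟨ cong (λ l → K * den * (d ! * 2 ^ d * l)) (ΛS≡cubes S d s) ⟩
  K * den * (d ! * 2 ^ d * cubes s d (𝟙 ∘ S))
    ≤⟨ *-monoʳ-≤ (K * den) (cubes≤hits s n d (𝟙 ∘ S)) ⟩
  K * den * hits s d (𝟙 ∘ S)
    ≡⟨ cong (K * den *_) (T-map d 𝟙 (λ φ → 𝟙 (total d φ ≡ᵇ s)) S) ⟨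
  K * den * T d ind S
    ≤⟨ +-cancelʳ-≤ (T d (λ _ → c) S) _ _ summed ⟩
  T d (λ _ → K * num) S
    ≡⟨ T-const d (K * num) S ⟩
  n ^ d * (2 ^ n * (K * num))
    ≡⟨ *-assoc (n ^ d) (2 ^ n) (K * num) ⟨
  n ^ d * 2 ^ n * (K * num)
    ≡⟨ *-comm (n ^ d * 2 ^ n) (K * num) ⟩
  K * num * (n ^ d * 2 ^ n)
    ≡⟨ *-assoc K num _ ⟩
  K * (num * (n ^ d * 2 ^ n)) ∎)
  where
  open ≤-Reasoning
  ind : Pow d Bool → ℕ
  ind φ = 𝟙 (points d φ ≡ᵇ s)
  summed : K * den * T d ind S + T d (λ _ → c) S ≤ T d (λ _ → K * num) S + T d (λ _ → c) S
  summed = begin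
    K * den * T d ind S + T d (λ _ → c) S      ≤⟨ +-monoʳ-≤ (K * den * T d ind S) (lb .bound S) ⟩
    K * den * T d ind S + T d m S              ≡⟨ cong (_+ T d m S) (T-*ˡ d (K * den) ind S) ⟨
    T d (λ φ → K * den * ind φ) S + T d m S    ≡⟨ T-+ d (λ φ → K * den * ind φ) m S ⟨
    T d (λ φ → K * den * ind φ + m φ) S        ≤⟨ T-mono d pointwise S ⟩
    T d (λ _ → K * num + c) S                  ≡⟨ T-+ d (λ _ → K * num) (λ _ → c) S ⟩
    T d (λ _ → K * num) S + T d (λ _ → c) S ∎

-- Symmetrisation over the directions of the face.

τ₁₂ τ₂₃ τ₃₄ : Q 4 → Q 4
τ₁₂ = mapPow 2 transpose
τ₂₃ = mapPow 1 transpose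
τ₃₄ = transpose

-- One coset representative for each of the six pairs of directions.
directions₄ : (Q 4 → ℕ) → Q 4 → ℕ
directions₄ h φ = h φ + (h (τ₂₃ φ) + (h (τ₂₃ (τ₁₂ φ)) +
  (h (τ₂₃ (τ₃₄ φ)) + (h (τ₂₃ (τ₁₂ (τ₃₄ φ))) + h (τ₂₃ (τ₁₂ (τ₃₄ (τ₂₃ φ))))))))

avg-directions₄ : ∀ {c h} → AvgAtLeast 4 {Bool} c h →
                  AvgAtLeast 4 {Bool} (c + (c + (c + (c + (c + c))))) (directions₄ h)
avg-directions₄ {c} {h} lb =
  avg-+ 4 lb (avg-+ 4 b (avg-+ 4 (avg-sym 4 s₁₂ b) (avg-+ 4 (avg-sym 4 s₃₄ b)
    (avg-+ 4 d (avg-sym 4 s₂₃ d)))))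
  where
  s₁₂ : Symmetry 4 {Bool} τ₁₂
  s₁₂ = transpose-sym 2
  s₂₃ : Symmetry 4 {Bool} τ₂₃
  s₂₃ = lift-sym 3 (transpose-sym 1)
  s₃₄ : Symmetry 4 {Bool} τ₃₄
  s₃₄ = lift-sym 3 (lift-sym 2 (transpose-sym 0))
  b : AvgAtLeast 4 {Bool} c (h ∘ τ₂₃)
  b = avg-sym 4 s₂₃ lb
  d : AvgAtLeast 4 {Bool} c (h ∘ τ₂₃ ∘ τ₁₂ ∘ τ₃₄)
  d = avg-sym 4 s₃₄ (avg-sym 4 s₁₂ b)

-- The face is an edge here: one term for each of its three possible directions.
directions₃ : (Q 3 → ℕ) → Q 3 → ℕ
directions₃ h φ = h φ + (h (mapPow 1 transpose φ) + h (mapPow 1 transpose (transpose φ)))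

avg-directions₃ : ∀ {c h} → AvgAtLeast 3 {Bool} c h → AvgAtLeast 3 {Bool} (c + (c + c)) (directions₃ h)
avg-directions₃ {c} {h} lb =
  avg-+ 3 lb (avg-+ 3 b (avg-sym 3 (lift-sym 2 (transpose-sym 0)) b))
  where
  b : AvgAtLeast 3 {Bool} c (h ∘ mapPow 1 transpose)
  b = avg-sym 3 (transpose-sym 1) lb

-- The certificates.

Square : Set
Square = Q 2

-- In the extremal constructions for (3,2) and (4,4) a neighbour of a point outside S lies in S with
-- probability 1/3, so u has mean zero on it.
u : Bool → ℤ
u b = if b then - (+ 2) else + 1

-- Weights use only the endpoints of the base edge outside `S`, where `u` has mean zero. On the
-- empty edge they split into a symmetric and an antisymmetric part.
edges₃₂ : Q 1 → Squares (Q 1)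
edges₃₂ (false , false) = (3 , λ (a , b) → u a ℤ.+ u b) ∷ (1 , λ (a , b) → u a ℤ.- u b) ∷ []
edges₃₂ (false , true) = (3 , u ∘ proj₁) ∷ []
edges₃₂ (true , false) = (3 , u ∘ proj₂) ∷ []
edges₃₂ (true , true) = []

reflect₁ reflect₂ : Square → Square
reflect₁ ((a , b) , (c , d)) = (b , a) , (d , c)
reflect₂ ((a , b) , (c , d)) = (c , d) , (a , b)

_after_ : Squares Square → (Square → Square) → Squares Square
ws after ρ = map (λ (k , w) → k , w ∘ ρ) ws

-- Reflections carry the three given certificates to all single points and both diagonals. Squares
-- with two adjacent points of `S` get no squares: they do not occur in the extremal constructions,
-- whose colours are nonzero.
bySquareType : (empty corner diagonal : Squares Square) → Square → Squares Square
bySquareType e c d ((false , false) , (false , false)) = e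
bySquareType e c d ((true , false) , (false , false)) = c
bySquareType e c d ((false , true) , (false , false)) = c after reflect₁
bySquareType e c d ((false , false) , (true , false)) = c after reflect₂
bySquareType e c d ((false , false) , (false , true)) = c after (reflect₁ ∘ reflect₂)
bySquareType e c d ((true , false) , (false , true)) = d
bySquareType e c d ((false , true) , (true , false)) = d after reflect₁
bySquareType e c d _ = []

-- The arguments are the values on the seven squares without adjacent points of `S`: the empty one,
-- the four single points, the two diagonals.
flags : (e v₀₀ v₁₀ v₀₁ v₁₁ d₀ d₁ : ℤ) → Square → ℤ
flags e v₀₀ v₁₀ v₀₁ v₁₁ d₀ d₁ ((false , false) , (false , false)) = e
flags e v₀₀ v₁₀ v₀₁ v₁₁ d₀ d₁ ((true , false) , (false , false)) = v₀₀
flags e v₀₀ v₁₀ v₀₁ v₁₁ d₀ d₁ ((false , true) , (false , false)) = v₁₀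
flags e v₀₀ v₁₀ v₀₁ v₁₁ d₀ d₁ ((false , false) , (true , false)) = v₀₁
flags e v₀₀ v₁₀ v₀₁ v₁₁ d₀ d₁ ((false , false) , (false , true)) = v₁₁
flags e v₀₀ v₁₀ v₀₁ v₁₁ d₀ d₁ ((true , false) , (false , true)) = d₀
flags e v₀₀ v₁₀ v₀₁ v₁₁ d₀ d₁ ((false , true) , (true , false)) = d₁
flags e v₀₀ v₁₀ v₀₁ v₁₁ d₀ d₁ _ = + 0

-- Every weight vanishes on average in the extremal construction: over a random direction, an empty
-- square is followed by the empty one with probability 3/7 and by each single vertex with 1/7, or by
-- the empty one with probability 5/7 and by each diagonal with 1/7; a single vertex is followed by the
-- empty square with probability 4/7 and by each other vertex with 1/7; a diagonal by the empty square
-- with probability 6/7 and by the other diagonal with 1/7.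
squares₄₂ : Square → Squares Square
squares₄₂ = bySquareType
  ( (1782  , flags (- (+ 4)) (+ 3) (+ 3) (+ 3) (+ 3) (+ 10) (+ 10))
  ∷ (36519 , flags (+ 0) (+ 1) (+ 1) (- (+ 1)) (- (+ 1)) (+ 0) (+ 0))
  ∷ (36519 , flags (+ 0) (+ 1) (- (+ 1)) (+ 1) (- (+ 1)) (+ 0) (+ 0))
  ∷ (23205 , flags (+ 0) (+ 1) (- (+ 1)) (- (+ 1)) (+ 1) (+ 0) (+ 0))
  ∷ [])
  ( (1859  , flags (- (+ 3)) (+ 6) (+ 4) (+ 4) (+ 4) (+ 0) (+ 0))
  ∷ (16786 , flags (+ 0) (+ 0) (- (+ 1)) (- (+ 1)) (+ 2) (+ 0) (+ 0))
  ∷ (48510 , flags (+ 0) (+ 0) (+ 1) (- (+ 1)) (+ 0) (+ 0) (+ 0))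
  ∷ [])
  ( (792   , flags (- (+ 1)) (+ 0) (+ 0) (+ 0) (+ 0) (+ 0) (+ 6))
  ∷ [])

-- Only corners where the base square misses `S` contribute, so the mean is zero in the extremal
-- construction for (4,4).
masked : Square → Square → ℤ
masked ((a , b) , (c , d)) ((a′ , b′) , (c′ , d′)) = m a a′ ℤ.+ m b b′ ℤ.+ m c c′ ℤ.+ m d d′
  where
  m : Bool → Bool → ℤ
  m f e = if f then + 0 else u e

squares₄₄ : Square → Squares Square
squares₄₄ F = (13 , masked F) ∷ bySquareType
  -- In the extremal construction the two directions of an empty square have equal colours. Opposite
  -- corners then have neighbours in `S` simultaneously, and these differences vanish.
  ( (13 , λ ((a , b) , (c , d)) → u a ℤ.- u d)
  ∷ (13 , λ ((a , b) , (c , d)) → u b ℤ.- u c)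
  ∷ [])
  ( (14 , λ ((a , b) , (c , d)) → u b)
  ∷ (14 , λ ((a , b) , (c , d)) → u c)
  ∷ (18 , λ ((a , b) , (c , d)) → u d)
  ∷ [])
  ( (13 , λ ((a , b) , (c , d)) → u b ℤ.- u c)
  ∷ []) F

-- Verification of the certificates.

check : ∀ k (s a b : ℕ) (pts : Q k → ℕ) (symmetrise : (Q k → ℕ) → Q k → ℕ) → Memo k ℕ → Bool
check k s a b pts symmetrise t = all k λ φ → a * 𝟙 (pts φ ≡ᵇ s) + symmetrise (lookup k t) φ ≤ᵇ b

check-sound : ∀ k s a b pts symmetrise t → check k s a b pts symmetrise t ≡ true →
              ∀ φ → a * 𝟙 (pts φ ≡ᵇ s) + symmetrise (lookup k t) φ ≤ b
check-sound k s a b pts symmetrise t ok φ = ≤ᵇ⇒≤ _ _ (Equivalence.from T-≡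
  (all-sound k (λ φ → a * 𝟙 (pts φ ≡ᵇ s) + symmetrise (lookup k t) φ ≤ᵇ b) ok φ))

upper₃ : ∀ s K num den c (t : Memo 3 ℕ) .{{_ : NonZero K}} → AvgAtLeast 2 {Q 1} c (lookup 3 t) →
  check 3 s (K * den) (K * num + 3 * c) (points 3) directions₃ t ≡ true →
  ∀ {n} (S : Subset n) → den * (3 ! * 2 ^ 3 * ΛS S 3 s) ≤ num * (n ^ 3 * 2 ^ n)
upper₃ s K num den c t lb ok = upper-bound 3 s K num den
  (subst (λ c → AvgAtLeast 3 {Bool} c (directions₃ (lookup 3 t))) (arith c) (avg-directions₃ (avg-lift 2 lb)))
  (check-sound 3 s (K * den) (K * num + 3 * c) (points 3) directions₃ t ok)
  where
  arith : ∀ c → c + (c + c) ≡ 3 * c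
  arith = solve-∀

upper₄ : ∀ s K num den c (t : Memo 4 ℕ) .{{_ : NonZero K}} → AvgAtLeast 2 {Q 2} c (lookup 4 t) →
  check 4 s (K * den) (K * num + 6 * c) (points 4) directions₄ t ≡ true →
  ∀ {n} (S : Subset n) → den * (4 ! * 2 ^ 4 * ΛS S 4 s) ≤ num * (n ^ 4 * 2 ^ n)
upper₄ s K num den c t lb ok = upper-bound 4 s K num den
  (subst (λ c → AvgAtLeast 4 {Bool} c (directions₄ (lookup 4 t))) (arith c) (avg-directions₄ (avg-lift 3 (avg-lift 2 lb))))
  (check-sound 4 s (K * den) (K * num + 6 * c) (points 4) directions₄ t ok)
  where
  arith : ∀ c → c + (c + (c + (c + (c + c)))) ≡ 6 * c
  arith = solve-∀

upper₃₂ : ∀ {n} (S : Subset n) → 9 * (3 ! * 2 ^ 3 * ΛS S 3 2) ≤ 8 * (n ^ 3 * 2 ^ n)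
-- The offset `100` is large enough for nonnegative entries, and `400` counts it once for each
-- reflection. The second `refl` evaluates the inequality on all `2^8` labellings.
upper₃₂ = upper₃ 2 18 8 9 400 (faces table) (avg-faces refl) refl
  where open Certificate 1 100 edges₃₂

upper₄₂ : ∀ {n} (S : Subset n) → 343 * (4 ! * 2 ^ 4 * ΛS S 4 2) ≤ 264 * (n ^ 4 * 2 ^ n)
upper₄₂ = upper₄ 2 2592 264 343 400000 (faces table) (avg-faces refl) refl
  where open Certificate 2 100000 squares₄₂

upper₄₄ : ∀ {n} (S : Subset n) → 27 * (4 ! * 2 ^ 4 * ΛS S 4 4) ≤ 26 * (n ^ 4 * 2 ^ n)
upper₄₄ = upper₄ 4 192 26 27 4000 (faces table) (avg-faces refl) refl
  where open Certificate 2 1000 squares₄₄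

-- Convergence

-- The falling factorial `n(n−1)…(n−d+1)`, the number of injective `d`-tuples, written without
-- subtraction.
fall : ℕ → ℕ → ℕ
fall n zero = 1
fall zero (suc d) = 0
fall (suc n) (suc d) = suc n * fall n d

-- Among injective `(d+1)`-tuples from `n+1` elements, a distinguished element is absent or sits in
-- one of `d+1` positions.
fall-rec : ∀ n d → suc n * fall n d ≡ fall n (suc d) + suc d * fall n d
fall-rec zero zero = refl
fall-rec zero (suc d) = sym (*-zeroʳ d)
fall-rec (suc n) zero = arith n
  where
  arith : ∀ n → suc (suc n) * 1 ≡ suc n * 1 + 1 * 1
  arith = solve-∀
fall-rec (suc n) (suc d) = begin
  suc (suc n) * (suc n * F)           ≡⟨ arith₁ n F ⟩
  suc n * (F + suc n * F)             ≡⟨ cong (λ m → suc n * (F + m)) (fall-rec n d) ⟩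
  suc n * (F + (F′ + suc d * F))      ≡⟨ arith₂ n d F F′ ⟩
  suc n * F′ + suc (suc d) * (suc n * F) ∎
  where
  open ≡-Reasoning
  F = fall n d
  F′ = fall n (suc d)
  arith₁ : ∀ n F → suc (suc n) * (suc n * F) ≡ suc n * (F + suc n * F)
  arith₁ = solve-∀
  arith₂ : ∀ n d F F′ → suc n * (F + (F′ + suc d * F)) ≡ suc n * F′ + suc (suc d) * (suc n * F)
  arith₂ = solve-∀

-- An entry appended to an injective `d`-tuple is new or repeats one of its `d` entries.
n*fall : ∀ n d → n * fall n d ≡ fall n (suc d) + d * fall n d
n*fall n d = +-cancelˡ-≡ (fall n d) _ _ (trans (fall-rec n d) (arith (fall n d) (fall n (suc d)) d))
  where
  arith : ∀ F F′ d → F′ + suc d * F ≡ F + (F′ + d * F)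
  arith = solve-∀

fall≤^ : ∀ n d → fall n d ≤ n ^ d
fall≤^ n zero = ≤-refl
fall≤^ n (suc d) = begin
  fall n (suc d)                 ≤⟨ m≤m+n _ (d * fall n d) ⟩
  fall n (suc d) + d * fall n d  ≡⟨ n*fall n d ⟨
  n * fall n d                   ≤⟨ *-monoʳ-≤ n (fall≤^ n d) ⟩
  n ^ suc d ∎
  where open ≤-Reasoning

-- The binomial coefficient `d` over `2`, the number of pairs of positions that can coincide.
triangle : ℕ → ℕ
triangle zero = 0
triangle (suc d) = d + triangle d

-- Union bound: a given pair of positions coincides in a proportion `1/n` of the tuples.
^≤fall : ∀ n d → n * n ^ d ≤ n * fall n d + triangle d * n ^ d
^≤fall n zero = m≤m+n _ 0
^≤fall n (suc d) = begin
  n * (n * n ^ d)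
    ≤⟨ *-monoʳ-≤ n (^≤fall n d) ⟩
  n * (n * fall n d + triangle d * n ^ d)
    ≡⟨ cong (λ m → n * (m + triangle d * n ^ d)) (n*fall n d) ⟩
  n * (fall n (suc d) + d * fall n d + triangle d * n ^ d)
    ≤⟨ *-monoʳ-≤ n (+-monoˡ-≤ (triangle d * n ^ d) (+-monoʳ-≤ (fall n (suc d)) (*-monoʳ-≤ d (fall≤^ n d)))) ⟩
  n * (fall n (suc d) + d * n ^ d + triangle d * n ^ d)
    ≡⟨ arith n (fall n (suc d)) d (triangle d) (n ^ d) ⟩
  n * fall n (suc d) + triangle (suc d) * n ^ suc d ∎
  where
  open ≤-Reasoning
  arith : ∀ n F d t x → n * (F + d * x + t * x) ≡ n * F + (d + t) * (n * x)
  arith = solve-∀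

^<fall : ∀ n d q → triangle d * suc q < n → q * n ^ d < suc q * fall n d
^<fall n@(suc _) d q large = *-cancelˡ-< n _ _ (+-cancelʳ-< (n * n ^ d) _ _ (begin-strict
  n * (q * n ^ d) + n * n ^ d
    ≡⟨ arith₁ n q (n ^ d) ⟩
  suc q * (n * n ^ d)
    ≤⟨ *-monoʳ-≤ (suc q) (^≤fall n d) ⟩
  suc q * (n * fall n d + triangle d * n ^ d)
    ≡⟨ arith₂ q n (fall n d) (triangle d) (n ^ d) ⟩
  n * (suc q * fall n d) + triangle d * suc q * n ^ d
    <⟨ +-monoʳ-< (n * (suc q * fall n d)) (*-monoˡ-< (n ^ d) {{m^n≢0 n d}} large) ⟩
  n * (suc q * fall n d) + n * n ^ d ∎))
  where
  open ≤-Reasoning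
  arith₁ : ∀ n q x → n * (q * x) + n * x ≡ suc q * (n * x)
  arith₁ = solve-∀
  arith₂ : ∀ q n F t x → suc q * (n * F + t * x) ≡ n * (suc q * F) + t * suc q * x
  arith₂ = solve-∀

-- Both sides count base points with an injective direction tuple, the left one through the subcube
-- spanned.
numCubes≡fall : ∀ n d → d ! * 2 ^ d * numCubes n d ≡ 2 ^ n * fall n d
numCubes≡fall zero zero = refl
numCubes≡fall zero (suc d) = *-zeroʳ (suc d ! * 2 ^ suc d)
numCubes≡fall (suc n) zero = arith (2 ^ suc n)
  where
  arith : ∀ a → 1 * (1 * a) ≡ a * 1
  arith = solve-∀
numCubes≡fall (suc n) (suc d) = begin
  suc d ! * 2 ^ suc d * numCubes (suc n) (suc d)
    ≡⟨ cong (suc d ! * 2 ^ suc d *_) (numCubes-suc n d) ⟩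
  suc d ! * 2 ^ suc d * (numCubes n d + 2 * numCubes n (suc d))
    ≡⟨ arith₁ (suc d) (d !) (2 ^ d) (numCubes n d) (numCubes n (suc d)) ⟩
  2 * suc d * (d ! * 2 ^ d * numCubes n d) + 2 * (suc d ! * 2 ^ suc d * numCubes n (suc d))
    ≡⟨ cong₂ (λ a b → 2 * suc d * a + 2 * b) (numCubes≡fall n d) (numCubes≡fall n (suc d)) ⟩
  2 * suc d * (2 ^ n * fall n d) + 2 * (2 ^ n * fall n (suc d))
    ≡⟨ arith₂ (suc d) (2 ^ n) (fall n d) (fall n (suc d)) ⟩
  2 ^ suc n * (fall n (suc d) + suc d * fall n d)
    ≡⟨ cong (2 ^ suc n *_) (fall-rec n d) ⟨
  2 ^ suc n * fall (suc n) (suc d) ∎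
  where
  open ≡-Reasoning
  arith₁ : ∀ a b c e f → a * b * (2 * c) * (e + 2 * f) ≡ 2 * a * (b * c * e) + 2 * (a * b * (2 * c) * f)
  arith₁ = solve-∀
  arith₂ : ∀ a b e f → 2 * a * (b * e) + 2 * (b * f) ≡ 2 * b * (f + a * e)
  arith₂ = solve-∀

-- The first inequality fixes the sign of the difference, so the absolute value disappears; the
-- second is the claim with denominators cleared.
frac-close : ∀ a b num e p q .(c : Coprime (suc p) (suc q)) → num * b ≤ suc e * a →
  suc q * (suc e * a) < (suc q * num + suc e * suc p) * b →
  ℚ.∣ frac a b ℚ.- (+ num) / suc e ∣ ℚ.< mkℚ +[1+ p ] q c
-- The default value of `frac` at `0` never arises: the strict inequality would read `_ < 0`.
frac-close a zero num e p q c _ lt =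
  contradiction (subst (suc q * (suc e * a) <_) (*-zeroʳ (suc q * num + suc e * suc p)) lt) λ ()
frac-close a b@(suc b′) num e p q c le lt =
  ℚₚ.toℚᵘ-cancel-< (ℚᵘₚ.<-respˡ-≃ (ℚᵘₚ.≃-sym abs≃) (*<* cross))
  where
  m : ℕ
  m = suc e * a ∸ num * b

  difference : (+ a) ℤ.* + suc e ℤ.+ (ℤ.- (+ num)) ℤ.* + b ≡ + m
  difference = begin
    (+ a) ℤ.* + suc e ℤ.+ (ℤ.- (+ num)) ℤ.* + b
      ≡⟨ cong₂ ℤ._+_ (trans (ℤₚ.*-comm (+ a) (+ suc e)) (sym (ℤₚ.pos-* (suc e) a)))
           (trans (sym (ℤₚ.neg-distribˡ-* (+ num) (+ b))) (cong ℤ.-_ (sym (ℤₚ.pos-* num b)))) ⟩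
    (+ (suc e * a)) ℤ.- + (num * b)
      ≡⟨ ℤₚ.m-n≡m⊖n (suc e * a) (num * b) ⟩
    suc e * a ℤ.⊖ num * b
      ≡⟨ ℤₚ.⊖-≥ le ⟩
    + m ∎
    where open ≡-Reasoning

  abs≃ : toℚᵘ ℚ.∣ (+ a) / b ℚ.- (+ num) / suc e ∣ ℚᵘ.≃ mkℚᵘ (+ m) (e + b′ * suc e)
  abs≃ = ℚᵘₚ.≃-trans (ℚₚ.toℚᵘ-homo-∣-∣ ((+ a) / b ℚ.- (+ num) / suc e))
    (ℚᵘₚ.∣-∣-cong (ℚᵘₚ.≃-trans (ℚₚ.toℚᵘ-homo-+ ((+ a) / b) (ℚ.- ((+ num) / suc e)))
      (ℚᵘₚ.≃-trans (ℚᵘₚ.+-cong (ℚₚ.toℚᵘ-fromℚᵘ (mkℚᵘ (+ a) b′))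
          (ℚᵘₚ.≃-trans (ℚₚ.toℚᵘ-homo‿- ((+ num) / suc e)) (ℚᵘₚ.-‿cong (ℚₚ.toℚᵘ-fromℚᵘ (mkℚᵘ (+ num) e)))))
        (ℚᵘₚ.≃-reflexive (cong (λ z → mkℚᵘ z (e + b′ * suc e)) difference)))))

  small : m * suc q < suc p * (b * suc e)
  small = +-cancelˡ-< (suc q * (num * b)) _ _ (begin-strict
    suc q * (num * b) + m * suc q       ≡⟨ arith₁ (suc q) (num * b) m ⟩
    suc q * (num * b + m)               ≡⟨ cong (suc q *_) (m+[n∸m]≡n le) ⟩
    suc q * (suc e * a)                 <⟨ lt ⟩
    (suc q * num + suc e * suc p) * b   ≡⟨ arith₂ (suc q) num (suc e) (suc p) b ⟩
    suc q * (num * b) + suc p * (b * suc e) ∎)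
    where
    open ≤-Reasoning
    arith₁ : ∀ q x m → q * x + m * q ≡ q * (x + m)
    arith₁ = solve-∀
    arith₂ : ∀ q num e p b → (q * num + e * p) * b ≡ q * (num * b) + p * (b * e)
    arith₂ = solve-∀

  cross : (+ m) ℤ.* + suc q ℤ.< +[1+ p ] ℤ.* + (b * suc e)
  cross = subst₂ ℤ._<_ (ℤₚ.pos-* m (suc q)) (ℤₚ.pos-* (suc p) (b * suc e)) (ℤ.+<+ small)

-- The ratio lies between `num / den` and `num / den` times `n ^ d / fall n d`, and the last
-- quotient tends to `1`.
statConst : ∀ d s num e .{{_ : NonZero num}} → num ≤ suc e →
  (∀ {n} (S : Subset n) → suc e * (d ! * 2 ^ d * ΛS S d s) ≤ num * (n ^ d * 2 ^ n)) →
  (∀ n → num * numCubes n d ≤ suc e * Λ n d s) →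
  StatConstIs d s ((+ num) / suc e)
statConst d s num e num≤den upper lower (mkℚ (+ zero) q c) 0<ε = contradiction (ℚₚ.drop-*<* 0<ε) (ℤₚ.<-irrefl refl)
statConst d s num e num≤den upper lower (mkℚ -[1+ p ] q c) 0<ε = contradiction (ℚₚ.drop-*<* 0<ε) λ ()
statConst d s num e num≤den upper lower (mkℚ +[1+ p ] q c) 0<ε =
  -- Beyond this threshold `n ^ d / fall n d` is below `1 + 1/(q+1)`; by `num ≤ den` the error is
  -- below `1/(q+1)`, which is at most `ε`. The outer `suc` turns `≤` into `<`.
  suc (triangle d * suc (suc q)) , λ n large →
    frac-close (Λ n d s) (numCubes n d) num e p q c (lower n) (close n large)
  where
  k : ℕ
  k = d ! * 2 ^ d

  upperΛ : ∀ n → suc e * (k * Λ n d s) ≤ num * (n ^ d * 2 ^ n)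
  upperΛ n = begin
    suc e * (k * Λ n d s)  ≡⟨ *-assoc (suc e) k _ ⟨
    suc e * k * Λ n d s    ≤⟨ *max≤ (suc e * k) (λ S → ΛS S d s)
                                (λ S → ≤-trans (≤-reflexive (*-assoc (suc e) k _)) (upper S)) (allSubsets n) ⟩
    num * (n ^ d * 2 ^ n) ∎
    where open ≤-Reasoning

  close : ∀ n → triangle d * suc (suc q) < n →
          suc q * (suc e * Λ n d s) < (suc q * num + suc e * suc p) * numCubes n d
  close n large = *-cancelˡ-< k _ _ (begin-strict
    k * (suc q * (suc e * Λ n d s))
      ≡⟨ arith₁ k (suc q) (suc e) (Λ n d s) ⟩
    suc q * (suc e * (k * Λ n d s))
      ≤⟨ *-monoʳ-≤ (suc q) (upperΛ n) ⟩
    suc q * (num * (n ^ d * 2 ^ n))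
      ≡⟨ arith₂ (suc q) num (n ^ d) (2 ^ n) ⟩
    num * 2 ^ n * (suc q * n ^ d)
      <⟨ *-monoʳ-< (num * 2 ^ n) {{m*n≢0 num (2 ^ n) {{it}} {{m^n≢0 2 n}}}} (^<fall n d (suc q) large) ⟩
    num * 2 ^ n * (suc (suc q) * fall n d)
      ≡⟨ arith₃ num (2 ^ n) (suc q) (fall n d) ⟩
    (suc q * num + num * 1) * (2 ^ n * fall n d)
      ≤⟨ *-monoˡ-≤ (2 ^ n * fall n d) (+-monoʳ-≤ (suc q * num) (*-mono-≤ num≤den (s≤s (z≤n {p})))) ⟩
    (suc q * num + suc e * suc p) * (2 ^ n * fall n d)
      ≡⟨ cong ((suc q * num + suc e * suc p) *_) (numCubes≡fall n d) ⟨
    (suc q * num + suc e * suc p) * (k * numCubes n d)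
      ≡⟨ arith₄ (suc q * num + suc e * suc p) k (numCubes n d) ⟩
    k * ((suc q * num + suc e * suc p) * numCubes n d) ∎)
    where
    open ≤-Reasoning
    arith₁ : ∀ a b c f → a * (b * (c * f)) ≡ b * (c * (a * f))
    arith₁ = solve-∀
    arith₂ : ∀ a b c f → a * (b * (c * f)) ≡ b * f * (a * c)
    arith₂ = solve-∀
    arith₃ : ∀ a b c f → a * b * (suc c * f) ≡ (c * a + a * 1) * (b * f)
    arith₃ = solve-∀
    arith₄ : ∀ a b c → a * (b * c) ≡ b * (a * c)
    arith₄ = solve-∀

theorem1p3 : StatConstIs 3 2 ((+ 8) / 9) × StatConstIs 4 2 ((+ 264) / 343) × StatConstIs 4 4 ((+ 26) / 27)
theorem1p3 =
  statConst 3 2 8 8 (toWitness {a? = 8 ≤? 9} _) upper₃₂ lower₃₂ ,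
  statConst 4 2 264 342 (toWitness {a? = 264 ≤? 343} _) upper₄₂ lower₄₂ ,
  statConst 4 4 26 26 (toWitness {a? = 26 ≤? 27} _) upper₄₄ lower₄₄
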